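{- Let $f:\Sigma^*\to\Sigma^*$ be a sequential transduction. Then $f$ is $\mathcal{A}p$-sequential if and only if $f$ is $\mathcal{A}p$-rational.
   Context: A congruence $\sim$ on $\Sigma^*$ is aperiodic if there is $n$ with $w^n\sim w^{n+1}$ for all words $w$; $\mathcal{A}p(\Sigma)$ is the set of aperiodic congruences of finite index. For an automaton $\mathcal A=(Q,\Delta,I,F)$, its transition congruence is $u\approx_{\mathcal A}v$ iff for all $p,q\in Q$, there is a run on $u$ from $p$ to $q$ iff there is one on $v$; $\mathcal A$ is aperiodic if $\approx_{\mathcal A}$ is aperiodic. A transducer $\mathcal T=(\mathcal A,o,i,t)$ consists of an automaton $\mathcal A$, outputs $o:\Delta\to\Sigma^*$, initial outputs $i:I\to\Sigma^*$ and final outputs $t:F\to\Sigma^*$, realizing the pairs $(u,i(q_0)\,o(\text{run})\,t(q_n))$ for accepting runs on $u$; it is functional if this relation is a partial function and sequential if $\mathcal A$ is deterministic. A transduction is sequential if realized by a sequential transducer, $\mathcal{A}p$-rational if realized by a functional transducer with aperiodic underlying automaton, and $\mathcal{A}p$-sequential if realized by a sequential transducer with aperiodic underlying automaton. -}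

module Defs where

open import Data.Nat using (ℕ; suc)
open import Data.Fin using (Fin)
open import Data.Fin.Subset using (Subset; _∈_; ⁅_⁆)
open import Data.List using (List; []; _∷_; _++_; concat; replicate)
open import Data.Product using (_×_; _,_; ∃-syntax; Σ-syntax)
open import Level using (0ℓ)
open import Relation.Binary.Core using (Rel)
open import Relation.Binary.PropositionalEquality using (_≡_)
open import Function.Bundles using (_⇔_; mk⇔; Equivalence)
open import Function.Construct.Identity using (⇔-id)
open import Function.Construct.Symmetry using (⇔-sym)
open import Algebra.Structures using (IsMagma)

Word : ℕ → Set
Word k = List (Fin k)

infixr 8 _^_

_^_ : ∀ {k} → Word k → ℕ → Word k
w ^ n = concat (replicate n w)

-- `IsMagma _∼_ _++_` says exactly that _∼_ is an equivalence relation
-- compatible with concatenation on both sides.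
record Congruence (k : ℕ) : Set₁ where
  infix 4 _∼_
  field
    _∼_     : Rel (Word k) 0ℓ
    isMagma : IsMagma _∼_ _++_

AperiodicCongruence : ∀ {k} → Congruence k → Set
AperiodicCongruence C = ∃[ n ] (∀ w → w ^ n ∼ w ^ suc n)
  where open Congruence C

-- The transition set is curried: (p , a , q) is a transition iff q ∈ Δ p a.
record Automaton (k : ℕ) : Set where
  field
    size : ℕ

  Q : Set
  Q = Fin size

  field
    Δ : Q → Fin k → Subset size
    I : Subset size
    F : Subset size

module _ {k : ℕ} (A : Automaton k) where
  open Automaton A

  data Run : Q → Word k → Q → Set where
    []  : ∀ {p} → Run p [] p
    _∷_ : ∀ {p a q w r} → q ∈ Δ p a → Run q w r → Run p (a ∷ w) r

  Deterministic : Set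
  Deterministic =
      (∃[ q₀ ] I ≡ ⁅ q₀ ⁆)
    × (∀ p a {q r} → q ∈ Δ p a → r ∈ Δ p a → q ≡ r)

  TransitionEquiv : Rel (Word k) 0ℓ
  TransitionEquiv u v = ∀ p q → Run p u q ⇔ Run p v q

  private
    _++ᴿ_ : ∀ {u v p q r} → Run p u q → Run q v r → Run p (u ++ v) r
    []      ++ᴿ σ = σ
    (t ∷ ρ) ++ᴿ σ = t ∷ (ρ ++ᴿ σ)

    splitᴿ : ∀ u {v p r} → Run p (u ++ v) r → ∃[ q ] Run p u q × Run q v r
    splitᴿ []      ρ       = _ , [] , ρ
    splitᴿ (a ∷ u) (t ∷ ρ) with splitᴿ u ρ
    ... | q , ρ₁ , ρ₂ = q , t ∷ ρ₁ , ρ₂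

    replace : ∀ {u u′ v v′} → TransitionEquiv u u′ → TransitionEquiv v v′ →
              ∀ {p r} → Run p (u ++ v) r → Run p (u′ ++ v′) r
    replace {u} e f ρ with splitᴿ u ρ
    ... | q , ρ₁ , ρ₂ =
      Equivalence.to (e _ q) ρ₁ ++ᴿ Equivalence.to (f q _) ρ₂

    sym′ : ∀ {u v} → TransitionEquiv u v → TransitionEquiv v u
    sym′ e p q = ⇔-sym (e p q)

  transitionCongruence : Congruence k
  transitionCongruence = record
    { _∼_     = TransitionEquiv
    ; isMagma = record
      { isEquivalence = record
        { refl  = λ p q → ⇔-id _
        ; sym   = sym′
        ; trans = λ e f p q → mk⇔
            (λ ρ → Equivalence.to (f p q) (Equivalence.to (e p q) ρ))
            (λ ρ → Equivalence.from (e p q) (Equivalence.from (f p q) ρ))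
        }
      ; ∙-cong = λ e f p q → mk⇔ (replace e f) (replace (sym′ e) (sym′ f))
      }
    }

  Aperiodic : Set
  Aperiodic = AperiodicCongruence transitionCongruence

-- Membership in a `Subset` is proof-irrelevant, so o, i and t depend only on
-- the transition or state and not on the membership proof.
record Transducer (k : ℕ) : Set where
  field
    automaton : Automaton k

  open Automaton automaton public

  field
    o : ∀ {p a q} → q ∈ Δ p a → Word k
    i : ∀ {q} → q ∈ I → Word k
    t : ∀ {q} → q ∈ F → Word k

  output : ∀ {p w q} → Run automaton p w q → Word k
  output []      = []
  output (e ∷ ρ) = o e ++ output ρ

  Realized : Rel (Word k) 0ℓ
  Realized u v =
    ∃[ p ] ∃[ q ] Σ[ p∈I ∈ p ∈ I ] Σ[ ρ ∈ Run automaton p u q ] Σ[ q∈F ∈ q ∈ F ]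
      v ≡ i p∈I ++ output ρ ++ t q∈F

IsPartialFunction : ∀ {k} → Rel (Word k) 0ℓ → Set
IsPartialFunction R = ∀ {u v w} → R u v → R u w → v ≡ w

-- A partial function on words, given by its graph; its domain is not assumed
-- to be decidable.
record Transduction (k : ℕ) : Set₁ where
  field
    graph             : Rel (Word k) 0ℓ
    isPartialFunction : IsPartialFunction graph

module _ {k : ℕ} (T : Transducer k) where
  open Transducer T

  FunctionalTransducer : Set
  FunctionalTransducer = IsPartialFunction Realized

  SequentialTransducer : Set
  SequentialTransducer = Deterministic automaton

  AperiodicTransducer : Set
  AperiodicTransducer = Aperiodic automaton

  Realizes : Transduction k → Set
  Realizes f = ∀ u v → Transduction.graph f u v ⇔ Realized u v

module _ {k : ℕ} (f : Transduction k) where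

  Sequential : Set
  Sequential = ∃[ T ] SequentialTransducer T × Realizes T f

  Ap-Rational : Set
  Ap-Rational = ∃[ T ] FunctionalTransducer T × AperiodicTransducer T × Realizes T f

  Ap-Sequential : Set
  Ap-Sequential = ∃[ T ] SequentialTransducer T × AperiodicTransducer T × Realizes T f

{-# OPTIONS --safe #-}
-- Let f be realized by a sequential machine D. Pushing every output as early as possible and then
-- identifying accessible states with equal residual functions keeps the machine sequential and
-- makes its states the residuals of f up to a left factor; what has to be shown is that, when an
-- aperiodic functional transducer T also realizes f, the residuals of f after u w^i and u w^(i+1)
-- agree for i large, uniformly in u and w.
--
-- Pumping in T: a long run over w^i visits some state s twice, and by aperiodicity s then has
-- loops over all large powers of w. Functionality makes the outputs of these loops geometric, so
-- f(u w^(i+r) v) = α β^r γ for all r. In D the state after u w^i lies on a cycle of some length p,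
-- so f(u w^(i+jp) v) = A B^j κ with A and B independent of v. In the free group this gives
-- (α β α⁻¹)^p = A B A⁻¹; roots being unique there, α β α⁻¹ is independent of v too, so passing from
-- w^(i+jp) to w^(i+jp+1) multiplies f by a factor which does not depend on v.
module Submission where

open import Defs
open import Algebra.Structures using (IsMagma)
open import Data.Bool using (Bool; true; false; if_then_else_)
open import Data.Fin as Fin using (Fin; zero; suc; toℕ)
import Data.Fin.Properties as Fin
open import Data.Fin.Subset using (Subset; _∈_; ⁅_⁆; Nonempty)
open import Data.Fin.Subset.Properties using (_∈?_; nonempty?; x∈⁅x⁆; x∈⁅y⁆⇒x≡y)
open import Data.List using (List; []; _∷_; _++_; length; take; drop)
open import Data.List.Properties
  using (++-assoc; ++-identityʳ; ++-identityʳ-unique; ++-cancelˡ; ++-cancelʳ; ++-conicalˡ; ++-monoid;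
         ∷-injective; ∷-injectiveˡ; ∷-injectiveʳ; ≡-dec; length-++; length-take; length-drop;
         take++drop≡id)
open import Data.Maybe as Maybe using (Maybe; just; nothing; fromMaybe; is-just)
import Data.Maybe.Properties as Maybe
open import Data.Nat using (ℕ; zero; suc; _+_; _*_; _∸_; _≤_; _<_; z≤n; s≤s; >-nonZero)
open import Data.Nat.Induction using (<-wellFounded)
open import Data.Nat.Properties
open import Data.Nat.Tactic.RingSolver using (solve-∀)
open import Data.Product using (_×_; _,_; ∃-syntax; Σ-syntax; proj₁; proj₂)
open import Data.Sum using (_⊎_; inj₁; inj₂)
import Data.Vec as Vec
open import Data.Vec.Properties using ([]=⇒lookup; lookup⇒[]=; lookup∘tabulate)
open import Data.Vec.Properties.WithK using ([]=-irrelevant)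
open import Function using (_∘_)
open import Function.Bundles using (_⇔_; mk⇔; Equivalence)
open import Induction.WellFounded using (Acc; acc)
open import Relation.Binary.PropositionalEquality
  using (_≡_; _≗_; refl; sym; trans; cong; cong₂; subst; subst₂; module ≡-Reasoning)
open import Relation.Nullary
  using (¬_; Dec; yes; no; contradiction; map′; _×-dec_; _⊎-dec_; ¬?; does)
open import Relation.Nullary.Decidable using (decidable-stable; dec-true; dec-false; does-⇔)
open import Relation.Unary using (Decidable)
open import Tactic.MonoidSolver using (solve)

open Equivalence using (to; from)

private variable
  k : ℕ

-- Combinatorics on words

^-+ : (w : Word k) (m n : ℕ) → w ^ (m + n) ≡ w ^ m ++ w ^ n
^-+ w zero    n = refl
^-+ w (suc m) n = trans (cong (w ++_) (^-+ w m n)) (sym (++-assoc w (w ^ m) (w ^ n)))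

^-comm : (w : Word k) (m n : ℕ) → w ^ m ++ w ^ n ≡ w ^ n ++ w ^ m
^-comm w m n = trans (sym (^-+ w m n)) (trans (cong (w ^_) (+-comm m n)) (^-+ w n m))

^-1 : (w : Word k) → w ^ 1 ≡ w
^-1 w = ++-identityʳ w

length-^ : (w : Word k) (n : ℕ) → length (w ^ n) ≡ n * length w
length-^ w zero    = refl
length-^ w (suc n) = trans (length-++ w) (cong (length w +_) (length-^ w n))

[]-^ : (n : ℕ) → [] {A = Fin k} ^ n ≡ []
[]-^ zero    = refl
[]-^ (suc n) = []-^ n

length≡0 : (w : Word k) → length w ≡ 0 → w ≡ []
length≡0 [] _ = refl

-- In the free group `x` is the conjugate of `z` by `y`, and conjugation commutes with powers. With
-- `x`, `y`, `z` equal it moves one factor across a power.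
++-commute-^ : (x y z : Word k) (n : ℕ) → x ++ y ≡ y ++ z → x ^ n ++ y ≡ y ++ z ^ n
++-commute-^ x y z zero    e = sym (++-identityʳ y)
++-commute-^ x y z (suc n) e = begin
  (x ++ x ^ n) ++ y ≡⟨ ++-assoc x (x ^ n) y ⟩
  x ++ (x ^ n ++ y) ≡⟨ cong (x ++_) (++-commute-^ x y z n e) ⟩
  x ++ (y ++ z ^ n) ≡⟨ ++-assoc x y (z ^ n) ⟨
  (x ++ y) ++ z ^ n ≡⟨ cong (_++ z ^ n) e ⟩
  (y ++ z) ++ z ^ n ≡⟨ ++-assoc y z (z ^ n) ⟩
  y ++ (z ++ z ^ n) ∎
  where open ≡-Reasoning

^-* : (w : Word k) (m n : ℕ) → w ^ (m * n) ≡ (w ^ n) ^ m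
^-* w zero    n = refl
^-* w (suc m) n = trans (^-+ w n (m * n)) (cong (w ^ n ++_) (^-* w m n))

-- Levi's lemma.
++-overlap : (x y : Word k) {u v : Word k} → x ++ u ≡ y ++ v → length x ≤ length y →
          ∃[ d ] (y ≡ x ++ d × u ≡ d ++ v)
++-overlap []      y       e _       = y , refl , e
++-overlap (a ∷ x) (b ∷ y) e (s≤s l) with ∷-injective e
... | refl , e′ with ++-overlap x y e′ l
... | d , p , q = d , cong (a ∷_) p , q

++-overlap-≡ : (x y : Word k) {u v : Word k} → x ++ u ≡ y ++ v → length x ≡ length y → x ≡ y
++-overlap-≡ x y e l with ++-overlap x y e (≤-reflexive l)
... | []    , p , _ = sym (trans p (++-identityʳ x))
... | c ∷ d , p , _ = contradiction
  (trans (sym (length-++ x)) (trans (sym (cong length p)) (sym l)))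
  (m+1+n≢m (length x))

length-^≥ : (w : Word k) {n : ℕ} → 1 ≤ length w → n ≤ length (w ^ n)
length-^≥ w {n} p = subst (n ≤_) (sym (length-^ w n)) (m≤m*n n (length w) {{>-nonZero p}})

^-unroll : (x y z : Word k) (n : ℕ) → x ++ y ≡ y ++ z → length y ≤ length (x ^ n) →
           ∃[ d ] x ^ n ≡ y ++ d
^-unroll x y z n e l with ++-overlap y (x ^ n) (sym (++-commute-^ x y z n e)) l
... | d , p , _ = d , p

-- Uniqueness of roots in a free group, for conjugates by d: both x ++ d and d ++ y are
-- prefixes of the same word x ^ n ++ d with n large.
conjugate-root-nonempty : (x y d : Word k) (m : ℕ) → 1 ≤ length x → length x ≡ length y →
                          x ^ suc m ++ d ≡ d ++ y ^ suc m → x ++ d ≡ d ++ y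
conjugate-root-nonempty x y d m x≢[] same-length e =
  ++-overlap-≡ (x ++ d) (d ++ y) {(r ++ x ^ m) ++ d} {y ^ m ++ y ^ (n * p)} common lengths
  where
  open ≡-Reasoning
  p = suc m
  -- `x ^ p` is nonempty, so `length d` copies of it are at least as long as `d`, as `^-unroll`
  -- requires.
  n = length d
  monoid = ++-monoid (Fin _)
  e-n : (x ^ p) ^ n ++ d ≡ d ++ (y ^ p) ^ n
  e-n = ++-commute-^ (x ^ p) d (y ^ p) n e
  unroll = ^-unroll (x ^ p) d (y ^ p) n e
    (length-^≥ (x ^ p) (≤-trans x≢[] (≤-trans (m≤m+n _ _) (≤-reflexive (sym (length-++ x))))))
  r = proj₁ unroll
  lengths : length (x ++ d) ≡ length (d ++ y)
  lengths = trans (length-++ x) (trans (+-comm (length x) _)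
    (trans (cong (length d +_) same-length) (sym (length-++ d))))
  common : (x ++ d) ++ ((r ++ x ^ m) ++ d) ≡ (d ++ y) ++ (y ^ m ++ y ^ (n * p))
  common = begin
    (x ++ d) ++ ((r ++ x ^ m) ++ d)        ≡⟨ solve monoid ⟩
    x ++ (d ++ r) ++ x ^ m ++ d            ≡⟨ cong (λ z → x ++ z ++ x ^ m ++ d) (proj₂ unroll) ⟨
    x ++ (x ^ p) ^ n ++ x ^ m ++ d         ≡⟨ cong (λ z → x ++ z ++ x ^ m ++ d) (^-* x n p) ⟨
    x ++ x ^ (n * p) ++ x ^ m ++ d         ≡⟨ cong (x ++_) (++-assoc (x ^ (n * p)) _ d) ⟨
    x ++ (x ^ (n * p) ++ x ^ m) ++ d       ≡⟨ cong (λ z → x ++ z ++ d) (^-comm x (n * p) m) ⟩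
    x ++ (x ^ m ++ x ^ (n * p)) ++ d       ≡⟨ cong (λ z → x ++ (x ^ m ++ z) ++ d) (^-* x n p) ⟩
    x ++ (x ^ m ++ (x ^ p) ^ n) ++ d       ≡⟨ cong (x ++_) (++-assoc (x ^ m) _ d) ⟩
    x ++ x ^ m ++ (x ^ p) ^ n ++ d         ≡⟨ cong (λ z → x ++ x ^ m ++ z) e-n ⟩
    x ++ x ^ m ++ d ++ (y ^ p) ^ n         ≡⟨ solve monoid ⟩
    ((x ++ x ^ m) ++ d) ++ (y ^ p) ^ n     ≡⟨ cong (_++ (y ^ p) ^ n) e ⟩
    (d ++ y ++ y ^ m) ++ (y ^ p) ^ n       ≡⟨ cong ((d ++ y ++ y ^ m) ++_) (^-* y n p) ⟨
    (d ++ y ++ y ^ m) ++ y ^ (n * p)       ≡⟨ solve monoid ⟩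
    (d ++ y) ++ (y ^ m ++ y ^ (n * p))     ∎

^-length-injective : (x y : Word k) (m : ℕ) → length (x ^ suc m) ≡ length (y ^ suc m) →
                     length x ≡ length y
^-length-injective x y m e = *-cancelˡ-≡ (length x) (length y) (suc m)
  (trans (sym (length-^ x (suc m))) (trans e (length-^ y (suc m))))

-- Comparing lengths in the hypothesis shows that `x` and `y` are equally long. Hence an empty `x`
-- forces an empty `y`, and otherwise the nonempty case applies.
conjugate-root : (x y d : Word k) (m : ℕ) → x ^ suc m ++ d ≡ d ++ y ^ suc m → x ++ d ≡ d ++ y
conjugate-root x y d m e = by-length x refl
  where
  open ≡-Reasoning
  same-length : length x ≡ length y
  same-length = ^-length-injective x y m (+-cancelʳ-≡ (length d) _ _ (begin
    length (x ^ suc m) + length d ≡⟨ length-++ (x ^ suc m) ⟨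
    length (x ^ suc m ++ d)       ≡⟨ cong length e ⟩
    length (d ++ y ^ suc m)       ≡⟨ length-++ d ⟩
    length d + length (y ^ suc m) ≡⟨ +-comm (length d) _ ⟩
    length (y ^ suc m) + length d ∎))
  by-length : (x′ : Word _) → x′ ≡ x → x ++ d ≡ d ++ y
  by-length []      refl =
    sym (trans (cong (d ++_) (length≡0 y (sym same-length))) (++-identityʳ d))
  by-length (_ ∷ _) refl = conjugate-root-nonempty x y d m (s≤s z≤n) same-length e

-- Both sides are the output on u w^(i + j p) v, p = suc m: the left one read off a run of an
-- aperiodic transducer, the right one off a sequential machine whose state after u w^i has a
-- loop over w^p. Only κ, and not A and B, depends on v in the latter.
Fits : ℕ → (A B α β γ κ : Word k) → Set
Fits m A B α β γ κ = ∀ j → α ++ β ^ (j * suc m) ++ γ ≡ A ++ B ^ j ++ κ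

-- With `B` empty the outputs for `j = 0` and `j = 1` coincide, so `β ^ suc m` is empty and `β` with
-- it.
fits-[] : (m : ℕ) (A α β γ κ : Word k) → Fits m A [] α β γ κ → α ++ β ^ 1 ++ γ ≡ A ++ κ
fits-[] m A α β γ κ fits = begin
  α ++ β ^ 1 ++ γ  ≡⟨ cong (λ z → α ++ z ++ γ) (^-1 β) ⟩
  α ++ β ++ γ      ≡⟨ cong (λ z → α ++ z ++ γ) β≡[] ⟩
  α ++ γ           ≡⟨ fits 0 ⟩
  A ++ κ           ∎
  where
  open ≡-Reasoning
  β^≡[] : β ^ suc m ≡ []
  β^≡[] = trans (cong (β ^_) (sym (*-identityˡ (suc m))))
    (++-cancelʳ γ _ [] (++-cancelˡ α _ _ (trans (fits 1) (sym (fits 0)))))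
  β≡[] : β ≡ []
  β≡[] = length≡0 β (^-length-injective β [] m (cong length (trans β^≡[] (sym ([]-^ (suc m))))))

module _ (m : ℕ) (A B : Word k) (j : ℕ) where
  open ≡-Reasoning

  private
    p = suc m

  -- Absorbing `j` periods into the left factors `α` and `A` leaves equations of the same shape:
  -- `fits-base` is the one for no further period, `fits-step` the one for a single further period.
  fits-step : ∀ α β γ κ → Fits m A B α β γ κ →
              (α ++ β ^ (j * p)) ++ β ^ p ++ γ ≡ (A ++ B ^ j) ++ B ++ κ
  fits-step α β γ κ fits = begin
    (α ++ β ^ (j * p)) ++ β ^ p ++ γ   ≡⟨ ++-assoc α _ _ ⟩
    α ++ β ^ (j * p) ++ β ^ p ++ γ     ≡⟨ cong (α ++_) (++-assoc (β ^ (j * p)) _ _) ⟨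
    α ++ (β ^ (j * p) ++ β ^ p) ++ γ   ≡⟨ cong (λ z → α ++ z ++ γ) (^-comm β (j * p) p) ⟩
    α ++ (β ^ p ++ β ^ (j * p)) ++ γ   ≡⟨ cong (λ z → α ++ z ++ γ) (^-+ β p (j * p)) ⟨
    α ++ β ^ (suc j * p) ++ γ          ≡⟨ fits (suc j) ⟩
    A ++ (B ++ B ^ j) ++ κ             ≡⟨ cong (λ z → A ++ z ++ κ) (++-commute-^ B B B j refl) ⟨
    A ++ (B ^ j ++ B) ++ κ             ≡⟨ cong (A ++_) (++-assoc (B ^ j) B κ) ⟩
    A ++ B ^ j ++ B ++ κ               ≡⟨ ++-assoc A (B ^ j) _ ⟨
    (A ++ B ^ j) ++ B ++ κ             ∎

  fits-base : ∀ α β γ κ → Fits m A B α β γ κ → (α ++ β ^ (j * p)) ++ γ ≡ (A ++ B ^ j) ++ κ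
  fits-base α β γ κ fits = trans (++-assoc α _ γ) (trans (fits j) (sym (++-assoc A _ κ)))

-- With `p = suc m`, the hypotheses say in the free group that `α₀ β₀^p α₀⁻¹ = A B A⁻¹ = α β^p α⁻¹`.
-- The longer of `α₀` and `α` is the shorter one followed by some `δ`, so `β₀^p` and `β^p` are
-- conjugate by `δ`, and `conjugate-root` removes the exponent. The left factor obtained involves
-- only the reference data `α₀`, `β₀`, `η`.
conjugate-shift : (m : ℕ) (A B α₀ β₀ η α β γ κ : Word k) →
  A ≡ α₀ ++ η → β₀ ^ suc m ++ η ≡ η ++ B →
  α ++ γ ≡ A ++ κ → α ++ β ^ suc m ++ γ ≡ A ++ B ++ κ →
  α ++ β ++ γ ≡ (α₀ ++ β₀ ++ η) ++ κ
conjugate-shift {k} m A B α₀ β₀ η α β γ κ A≡ β₀^η base step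
  with ≤-total (length α₀) (length α)
... | inj₁ le = conclude (++-overlap α₀ α base′ le)
  where
  open ≡-Reasoning
  p = suc m
  monoid = ++-monoid (Fin k)
  base′ : α₀ ++ η ++ κ ≡ α ++ γ
  base′ = trans (sym (++-assoc α₀ η κ)) (trans (cong (_++ κ) (sym A≡)) (sym base))
  conclude : ∃[ δ ] (α ≡ α₀ ++ δ × η ++ κ ≡ δ ++ γ) → α ++ β ++ γ ≡ (α₀ ++ β₀ ++ η) ++ κ
  conclude (δ , α≡ , ηκ≡) = begin
      α ++ β ++ γ              ≡⟨ cong (_++ β ++ γ) α≡ ⟩
      (α₀ ++ δ) ++ β ++ γ       ≡⟨ solve monoid ⟩
      α₀ ++ (δ ++ β) ++ γ       ≡⟨ cong (λ z → α₀ ++ z ++ γ) (conjugate-root β₀ β δ m root) ⟨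
      α₀ ++ (β₀ ++ δ) ++ γ      ≡⟨ solve monoid ⟩
      (α₀ ++ β₀) ++ δ ++ γ      ≡⟨ cong ((α₀ ++ β₀) ++_) ηκ≡ ⟨
      (α₀ ++ β₀) ++ η ++ κ      ≡⟨ solve monoid ⟩
      (α₀ ++ β₀ ++ η) ++ κ      ∎
    where
    root : β₀ ^ p ++ δ ≡ δ ++ β ^ p
    root = ++-cancelʳ γ _ _ (++-cancelˡ α₀ _ _ (begin
        α₀ ++ (β₀ ^ p ++ δ) ++ γ      ≡⟨ cong (α₀ ++_) (++-assoc (β₀ ^ p) δ γ) ⟩
        α₀ ++ β₀ ^ p ++ δ ++ γ        ≡⟨ cong (λ z → α₀ ++ β₀ ^ p ++ z) ηκ≡ ⟨
        α₀ ++ β₀ ^ p ++ η ++ κ        ≡⟨ cong (α₀ ++_) (++-assoc (β₀ ^ p) η κ) ⟨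
        α₀ ++ (β₀ ^ p ++ η) ++ κ      ≡⟨ cong (λ z → α₀ ++ z ++ κ) β₀^η ⟩
        α₀ ++ (η ++ B) ++ κ           ≡⟨ solve monoid ⟩
        (α₀ ++ η) ++ B ++ κ           ≡⟨ cong (_++ B ++ κ) A≡ ⟨
        A ++ B ++ κ        ≡⟨ step ⟨
        α ++ β ^ p ++ γ              ≡⟨ cong (_++ β ^ p ++ γ) α≡ ⟩
        (α₀ ++ δ) ++ β ^ p ++ γ       ≡⟨ ++-assoc α₀ δ _ ⟩
        α₀ ++ δ ++ β ^ p ++ γ         ≡⟨ cong (α₀ ++_) (++-assoc δ _ γ) ⟨
        α₀ ++ (δ ++ β ^ p) ++ γ       ∎))
... | inj₂ le = conclude (++-overlap α α₀ base′ le)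
  where
  open ≡-Reasoning
  p = suc m
  monoid = ++-monoid (Fin k)
  base′ : α ++ γ ≡ α₀ ++ η ++ κ
  base′ = trans base (trans (cong (_++ κ) A≡) (++-assoc α₀ η κ))
  conclude : ∃[ δ ] (α₀ ≡ α ++ δ × γ ≡ δ ++ η ++ κ) → α ++ β ++ γ ≡ (α₀ ++ β₀ ++ η) ++ κ
  conclude (δ , α₀≡ , γ≡) = begin
      α ++ β ++ γ              ≡⟨ cong (λ z → α ++ β ++ z) γ≡ ⟩
      α ++ β ++ δ ++ η ++ κ    ≡⟨ cong (α ++_) (++-assoc β δ _) ⟨
      α ++ (β ++ δ) ++ η ++ κ  ≡⟨ cong (λ z → α ++ z ++ η ++ κ) (conjugate-root β β₀ δ m root) ⟩
      α ++ (δ ++ β₀) ++ η ++ κ ≡⟨ cong (α ++_) (++-assoc δ β₀ _) ⟩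
      α ++ δ ++ β₀ ++ η ++ κ   ≡⟨ ++-assoc α δ _ ⟨
      (α ++ δ) ++ β₀ ++ η ++ κ ≡⟨ cong (_++ β₀ ++ η ++ κ) α₀≡ ⟨
      α₀ ++ β₀ ++ η ++ κ        ≡⟨ solve monoid ⟩
      (α₀ ++ β₀ ++ η) ++ κ      ∎
    where
    root : β ^ p ++ δ ≡ δ ++ β₀ ^ p
    root = ++-cancelʳ (η ++ κ) _ _ (++-cancelˡ α _ _ (begin
        α ++ (β ^ p ++ δ) ++ η ++ κ    ≡⟨ cong (α ++_) (++-assoc (β ^ p) δ _) ⟩
        α ++ β ^ p ++ δ ++ η ++ κ      ≡⟨ cong (λ z → α ++ β ^ p ++ z) γ≡ ⟨
        α ++ β ^ p ++ γ                ≡⟨ step ⟩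
        A ++ B ++ κ          ≡⟨ cong (_++ B ++ κ) A≡ ⟩
        (α₀ ++ η) ++ B ++ κ             ≡⟨ solve monoid ⟩
        α₀ ++ (η ++ B) ++ κ             ≡⟨ cong (λ z → α₀ ++ z ++ κ) β₀^η ⟨
        α₀ ++ (β₀ ^ p ++ η) ++ κ        ≡⟨ cong₂ _++_ α₀≡ (++-assoc (β₀ ^ p) η κ) ⟩
        (α ++ δ) ++ β₀ ^ p ++ η ++ κ   ≡⟨ ++-assoc α δ _ ⟩
        α ++ δ ++ β₀ ^ p ++ η ++ κ     ≡⟨ cong (α ++_) (++-assoc δ _ _) ⟨
        α ++ (δ ++ β₀ ^ p) ++ η ++ κ   ∎))

-- In the free group, α β^(j p) β γ is (α β α⁻¹) (A B^j) κ, and α β α⁻¹ is the p-th root of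
-- A B A⁻¹, hence the same for all (α , β , γ , κ).
uniform-shift : (m : ℕ) (A B : Word k) → ∀ α₀ β₀ γ₀ κ₀ → Fits m A B α₀ β₀ γ₀ κ₀ →
  ∃[ j ] ∃[ x ] ∀ α β γ κ → Fits m A B α β γ κ → α ++ β ^ (j * suc m + 1) ++ γ ≡ x ++ κ
uniform-shift m A []        α₀ β₀ γ₀ κ₀ fits₀ = 0 , A , fits-[] m A
uniform-shift m A B@(_ ∷ _) α₀ β₀ γ₀ κ₀ fits₀ = j , α₀ ++ β₀ ++ η , λ α β γ κ fits → begin
  α ++ β ^ (j * p + 1) ++ γ          ≡⟨ cong (λ z → α ++ z ++ γ) (^-+ β (j * p) 1) ⟩
  α ++ (β ^ (j * p) ++ β ^ 1) ++ γ   ≡⟨ cong (λ z → α ++ (β ^ (j * p) ++ z) ++ γ) (^-1 β) ⟩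
  α ++ (β ^ (j * p) ++ β) ++ γ       ≡⟨ cong (α ++_) (++-assoc (β ^ (j * p)) β γ) ⟩
  α ++ β ^ (j * p) ++ β ++ γ         ≡⟨ ++-assoc α _ _ ⟨
  (α ++ β ^ (j * p)) ++ β ++ γ       ≡⟨ conjugate-shift m (A ++ B ^ j) B α₀ β₀ η (α ++ β ^ (j * p)) β γ κ A≡ β₀^η
                                           (fits-base m A B j α β γ κ fits) (fits-step m A B j α β γ κ fits) ⟩
  (α₀ ++ β₀ ++ η) ++ κ               ∎
  where
  open ≡-Reasoning
  p = suc m
  -- `B` is nonempty here, so `B ^ j` is at least as long as `α₀`. This makes `α₀` a prefix of
  -- `A ++ B ^ j`, with quotient `η`.
  j = length α₀
  split = ++-overlap α₀ (A ++ B ^ j) (trans (fits₀ j) (sym (++-assoc A (B ^ j) κ₀)))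
    (≤-trans (length-^≥ B (s≤s z≤n)) (≤-trans (m≤n+m _ (length A)) (≤-reflexive (sym (length-++ A)))))
  η = proj₁ split
  A≡ = proj₁ (proj₂ split)
  β₀^η : β₀ ^ p ++ η ≡ η ++ B
  β₀^η = ++-cancelʳ κ₀ _ _ (++-cancelˡ α₀ _ _ (begin
    α₀ ++ (β₀ ^ p ++ η) ++ κ₀               ≡⟨ cong (α₀ ++_) (++-assoc (β₀ ^ p) η κ₀) ⟩
    α₀ ++ β₀ ^ p ++ η ++ κ₀                 ≡⟨ cong (λ z → α₀ ++ β₀ ^ p ++ z) (proj₂ (proj₂ split)) ⟨
    α₀ ++ β₀ ^ p ++ β₀ ^ (j * p) ++ γ₀      ≡⟨ cong (α₀ ++_) (++-assoc (β₀ ^ p) _ γ₀) ⟨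
    α₀ ++ (β₀ ^ p ++ β₀ ^ (j * p)) ++ γ₀    ≡⟨ cong (λ z → α₀ ++ z ++ γ₀) (^-comm β₀ p (j * p)) ⟩
    α₀ ++ (β₀ ^ (j * p) ++ β₀ ^ p) ++ γ₀    ≡⟨ cong (α₀ ++_) (++-assoc (β₀ ^ (j * p)) _ γ₀) ⟩
    α₀ ++ β₀ ^ (j * p) ++ β₀ ^ p ++ γ₀      ≡⟨ ++-assoc α₀ _ _ ⟨
    (α₀ ++ β₀ ^ (j * p)) ++ β₀ ^ p ++ γ₀    ≡⟨ fits-step m A B j α₀ β₀ γ₀ κ₀ fits₀ ⟩
    (A ++ B ^ j) ++ B ++ κ₀                 ≡⟨ cong (_++ B ++ κ₀) A≡ ⟩
    (α₀ ++ η) ++ B ++ κ₀                    ≡⟨ ++-assoc α₀ η _ ⟩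
    α₀ ++ η ++ B ++ κ₀                      ≡⟨ cong (α₀ ++_) (++-assoc η B κ₀) ⟨
    α₀ ++ (η ++ B) ++ κ₀                    ∎))

-- Geometric sequences of words

module _ (X : ℕ → Word k) (exchange : ∀ s t s′ t′ → s + t ≡ s′ + t′ → X s ++ X t ≡ X s′ ++ X t′) where
  private
    swap : ∀ t → X (suc t) ++ X 0 ≡ X t ++ X 1
    swap t = exchange (suc t) 0 t 1 (trans (+-identityʳ (suc t)) (+-comm 1 t))

    lengths : ∀ t → length (X t) + t * length (X 0) ≡ length (X 0) + t * length (X 1)
    lengths zero    = refl
    lengths (suc t) = begin
      c + (a + t * a)   ≡⟨ +-assoc c a _ ⟨
      (c + a) + t * a   ≡⟨ cong (_+ t * a) (trans (sym (length-++ (X (suc t)))) (trans (cong length (swap t)) (length-++ (X t)))) ⟩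
      (d + b) + t * a   ≡⟨ +-assoc d b _ ⟩
      d + (b + t * a)   ≡⟨ cong (d +_) (+-comm b _) ⟩
      d + (t * a + b)   ≡⟨ +-assoc d _ b ⟨
      (d + t * a) + b   ≡⟨ cong (_+ b) (lengths t) ⟩
      (a + t * b) + b   ≡⟨ +-assoc a _ b ⟩
      a + (t * b + b)   ≡⟨ cong (a +_) (+-comm _ b) ⟩
      a + (b + t * b)   ∎
      where
      open ≡-Reasoning
      a = length (X 0)
      b = length (X 1)
      c = length (X (suc t))
      d = length (X t)

    -- By `lengths` the lengths of the `X t` form an arithmetic progression. A negative common
    -- difference would make the term at index `suc (length (X 0))` negative.
    monotone : length (X 0) ≤ length (X 1)
    monotone with ≤-<-connex (length (X 0)) (length (X 1))
    ... | inj₁ le  = le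
    ... | inj₂ b<a = contradiction (lengths (suc a)) (<⇒≢ (begin-strict
      a + suc a * b                   <⟨ n<1+n _ ⟩
      suc a + suc a * b               ≡⟨ *-suc (suc a) b ⟨
      suc a * suc b                   ≤⟨ *-monoʳ-≤ (suc a) b<a ⟩
      suc a * a                       ≤⟨ m≤n+m _ (length (X (suc a))) ⟩
      length (X (suc a)) + suc a * a  ∎) ∘ sym)
      where
      open ≤-Reasoning
      a = length (X 0)
      b = length (X 1)

  -- `X 0` and `X 1` commute by `exchange`, and `X 0` is not the longer one, so `X 1 = β ++ X 0` for
  -- some `β`. Induction then uses `X (t + 1) X 0 = X t X 1` and cancels `X 0` on the right.
  geometric : ∃[ β ] ∀ t → X t ≡ X 0 ++ β ^ t
  geometric with ++-overlap (X 0) (X 1) (exchange 0 1 1 0 refl) monotone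
  ... | β , _ , X₁≡ = β , powers
    where
    open ≡-Reasoning
    powers : ∀ t → X t ≡ X 0 ++ β ^ t
    powers zero    = sym (++-identityʳ (X 0))
    powers (suc t) = ++-cancelʳ (X 0) _ _ (begin
      X (suc t) ++ X 0             ≡⟨ swap t ⟩
      X t ++ X 1                   ≡⟨ cong₂ _++_ (powers t) X₁≡ ⟩
      (X 0 ++ β ^ t) ++ β ++ X 0   ≡⟨ solve (++-monoid (Fin k)) ⟩
      X 0 ++ (β ^ t ++ β) ++ X 0   ≡⟨ cong (λ z → X 0 ++ z ++ X 0) (++-commute-^ β β β t refl) ⟩
      X 0 ++ (β ++ β ^ t) ++ X 0   ≡⟨ ++-assoc (X 0) _ (X 0) ⟨
      (X 0 ++ β ++ β ^ t) ++ X 0   ∎)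

-- Pumping in aperiodic transducers

module _ {A : Automaton k} where
  open Automaton A

  infixr 5 _++ᴿ_
  _++ᴿ_ : ∀ {u v p q r} → Run A p u q → Run A q v r → Run A p (u ++ v) r
  []      ++ᴿ σ = σ
  (e ∷ ρ) ++ᴿ σ = e ∷ (ρ ++ᴿ σ)

  splitᴿ : ∀ u {v p r} → Run A p (u ++ v) r → ∃[ q ] Run A p u q × Run A q v r
  splitᴿ []      ρ       = _ , [] , ρ
  splitᴿ (a ∷ u) (e ∷ ρ) with splitᴿ u ρ
  ... | q , ρ₁ , ρ₂ = q , e ∷ ρ₁ , ρ₂

  iterateᴿ : ∀ {s w} → Run A s w s → ∀ m → Run A s (w ^ m) s
  iterateᴿ ρ zero    = []
  iterateᴿ ρ (suc m) = ρ ++ᴿ iterateᴿ ρ m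

  visit : ∀ {w} m {p q} → Run A p (w ^ m) q → Fin (suc m) → Q
  visit {w} m       {p} ρ zero    = p
  visit {w} (suc m) ρ (suc i) = visit m (proj₂ (proj₂ (splitᴿ w ρ))) i

  visit-split : ∀ {w} m {p q} (ρ : Run A p (w ^ m) q) j →
    ∃[ c ] toℕ j + c ≡ m × Run A p (w ^ toℕ j) (visit m ρ j) × Run A (visit m ρ j) (w ^ c) q
  visit-split {w} m       ρ zero    = m , refl , [] , ρ
  visit-split {w} (suc m) ρ (suc j) with splitᴿ w ρ
  ... | _ , ρ₁ , ρ₂ with visit-split m ρ₂ j
  ... | c , eq , σ₁ , σ₂ = c , cong suc eq , ρ₁ ++ᴿ σ₁ , σ₂

  visit-loop : ∀ {w} m {p q} (ρ : Run A p (w ^ m) q) i j → i Fin.< j →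
    ∃[ a ] ∃[ b ] ∃[ c ] a + suc b + c ≡ m × Run A p (w ^ a) (visit m ρ i)
      × Run A (visit m ρ i) (w ^ suc b) (visit m ρ j) × Run A (visit m ρ j) (w ^ c) q
  visit-loop {w} (suc m) ρ zero    j@(suc j′) _ with visit-split (suc m) ρ j
  ... | c , eq , σ₁ , σ₂ = 0 , toℕ j′ , c , eq , [] , σ₁ , σ₂
  visit-loop {w} (suc m) ρ (suc i) (suc j) (s≤s i<j) with splitᴿ w ρ
  ... | _ , ρ₁ , ρ₂ with visit-loop m ρ₂ i j i<j
  ... | a , b , c , eq , σ₁ , σ₂ , σ₃ = suc a , b , c , cong suc eq , ρ₁ ++ᴿ σ₁ , σ₂ , σ₃

  -- The `suc m` states at the boundaries between copies of `w` cannot all differ.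
  find-loop : ∀ {w} m {p q} → size ≤ m → Run A p (w ^ m) q →
    ∃[ s ] ∃[ a ] ∃[ b ] ∃[ c ] a + suc b + c ≡ m × Run A p (w ^ a) s
      × Run A s (w ^ suc b) s × Run A s (w ^ c) q
  find-loop m size≤m ρ with Fin.pigeonhole (s≤s size≤m) (visit m ρ)
  ... | i , j , i<j , same with visit-loop m ρ i j i<j
  ... | a , b , c , eq , σ₁ , σ₂ , σ₃ =
    _ , a , b , c , eq , σ₁ , subst (Run A _ _) (sym same) σ₂ , subst (λ s → Run A s _ _) (sym same) σ₃

  stable : ∀ {n} → (∀ w → TransitionEquiv A (w ^ n) (w ^ suc n)) →
           ∀ w {i j} → n ≤ i → i ≤ j → TransitionEquiv A (w ^ i) (w ^ j)
  stable {n} ap w {i} {j} n≤i i≤j = subst (λ z → TransitionEquiv A (w ^ i) (w ^ z)) (m∸n+n≡m i≤j) (climb (j ∸ i))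
    where
    open IsMagma (Congruence.isMagma (transitionCongruence A))
      using (∙-cong) renaming (refl to ≈-refl; trans to ≈-trans)
    step₀ : ∀ r → TransitionEquiv A (w ^ (r + n)) (w ^ suc (r + n))
    step₀ zero    = ap w
    step₀ (suc r) = ∙-cong (≈-refl {w}) (step₀ r)
    step : ∀ {m} → n ≤ m → TransitionEquiv A (w ^ m) (w ^ suc m)
    step {m} n≤m = subst (λ z → TransitionEquiv A (w ^ z) (w ^ suc z)) (m∸n+n≡m n≤m) (step₀ (m ∸ n))
    climb : ∀ j → TransitionEquiv A (w ^ i) (w ^ (j + i))
    climb zero    = ≈-refl
    climb (suc j) = ≈-trans (climb j) (step (≤-trans n≤i (m≤n+m i j)))

module _ (T : Transducer k) where
  open Transducer T

  output-++ : ∀ {u v p q r} (ρ : Run automaton p u q) (σ : Run automaton q v r) →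
              output (ρ ++ᴿ σ) ≡ output ρ ++ output σ
  output-++ []      σ = refl
  output-++ (e ∷ ρ) σ = trans (cong (o e ++_) (output-++ ρ σ)) (sym (++-assoc (o e) _ _))

  module _ (functional : FunctionalTransducer T)
           {n : ℕ} (aperiodic : ∀ w → TransitionEquiv automaton (w ^ n) (w ^ suc n)) where

    -- The run over `w ^ i` can be exchanged for one over `w ^ j` with the same ends. The output may
    -- change, so only definedness is transported.
    domain-stable : ∀ u w v {i j y} → n ≤ i → n ≤ j →
                    Realized (u ++ w ^ i ++ v) y → ∃[ y′ ] Realized (u ++ w ^ j ++ v) y′
    domain-stable u w v {i} {j} n≤i n≤j (p , q , p∈I , ρ , q∈F , _) with splitᴿ u ρ
    ... | r , ρ₁ , ρ₂ with splitᴿ (w ^ i) ρ₂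
    ... | s , ρ₃ , ρ₄ = _ , p , q , p∈I , ρ₁ ++ᴿ move (≤-total i j) ++ᴿ ρ₄ , q∈F , refl
      where
      move : i ≤ j ⊎ j ≤ i → Run automaton r (w ^ j) s
      move (inj₁ i≤j) = to (stable aperiodic w n≤i i≤j r s) ρ₃
      move (inj₂ j≤i) = from (stable aperiodic w n≤j j≤i r s) ρ₃

    -- Two loops at `s` over the same word have the same output, since both extend to accepting runs
    -- on the same input and `T` is functional. Concatenating loops over `w ^ (e + a)` and
    -- `w ^ (e + b)` therefore gives an output depending only on `a + b`, so `geometric` applies.
    loops : ∀ {w p s q u v b} (p∈I : p ∈ I) (ρ : Run automaton p u s)
            (σ : Run automaton s (w ^ suc b) s) (τ : Run automaton s v q) (q∈F : q ∈ F) →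
            ∃[ α ] ∃[ β ] ∃[ γ ] ∀ t → Realized (u ++ w ^ (n * suc b + t) ++ v) (α ++ β ^ t ++ γ)
    loops {w} {p} {s} {q} {u} {v} {b} p∈I ρ σ τ q∈F =
      i p∈I ++ output ρ ++ output (loop 0) , proj₁ geo , output τ ++ t q∈F ,
      λ r → subst (Realized _) (shape r) (through (loop r))
      where
      open ≡-Reasoning
      -- A multiple of `suc b`, so that iterating `σ` gives a loop over `w ^ e`, and at least `n`,
      -- so that aperiodicity turns it into loops over every `w ^ (e + r)`.
      e = n * suc b
      n≤e : n ≤ e
      n≤e = m≤m*n n (suc b)
      loop : ∀ r → Run automaton s (w ^ (e + r)) s
      loop r = to (stable aperiodic w n≤e (m≤m+n e r) s s)
                  (subst (λ z → Run automaton s z s) (sym (^-* w n (suc b))) (iterateᴿ σ n))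
      through : ∀ {z} (λ′ : Run automaton s z s) →
                Realized (u ++ z ++ v) (i p∈I ++ output (ρ ++ᴿ λ′ ++ᴿ τ) ++ t q∈F)
      through λ′ = p , q , p∈I , ρ ++ᴿ λ′ ++ᴿ τ , q∈F , refl
      unfold : ∀ {z} (λ′ : Run automaton s z s) → i p∈I ++ output (ρ ++ᴿ λ′ ++ᴿ τ) ++ t q∈F
               ≡ (i p∈I ++ output ρ) ++ output λ′ ++ (output τ ++ t q∈F)
      unfold λ′ = begin
        i p∈I ++ output (ρ ++ᴿ λ′ ++ᴿ τ) ++ t q∈F
          ≡⟨ cong (λ z → i p∈I ++ z ++ t q∈F) (output-++ ρ _) ⟩
        i p∈I ++ (output ρ ++ output (λ′ ++ᴿ τ)) ++ t q∈F
          ≡⟨ cong (λ z → i p∈I ++ (output ρ ++ z) ++ t q∈F) (output-++ λ′ τ) ⟩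
        i p∈I ++ (output ρ ++ output λ′ ++ output τ) ++ t q∈F
          ≡⟨ solve (++-monoid (Fin k)) ⟩
        (i p∈I ++ output ρ) ++ output λ′ ++ (output τ ++ t q∈F) ∎
      same-output : ∀ {z z′} (λ₁ : Run automaton s z s) (λ₂ : Run automaton s z′ s) → z ≡ z′ →
                    output λ₁ ≡ output λ₂
      same-output λ₁ λ₂ refl = ++-cancelʳ (output τ ++ t q∈F) _ _ (++-cancelˡ (i p∈I ++ output ρ) _ _
        (trans (sym (unfold λ₁)) (trans (functional (through λ₁) (through λ₂)) (unfold λ₂))))
      exchange : ∀ a b c d → a + b ≡ c + d →
                 output (loop a) ++ output (loop b) ≡ output (loop c) ++ output (loop d)
      exchange a b c d eq = trans (sym (output-++ (loop a) (loop b)))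
        (trans (same-output (loop a ++ᴿ loop b) (loop c ++ᴿ loop d) words) (output-++ (loop c) (loop d)))
        where
        rearrange : ∀ e a b → (e + a) + (e + b) ≡ (e + e) + (a + b)
        rearrange = solve-∀
        words : w ^ (e + a) ++ w ^ (e + b) ≡ w ^ (e + c) ++ w ^ (e + d)
        words = trans (sym (^-+ w (e + a) (e + b))) (trans (cong (w ^_)
          (trans (rearrange e a b) (trans (cong (e + e +_) eq) (sym (rearrange e c d)))))
          (^-+ w (e + c) (e + d)))
      geo = geometric (λ r → output (loop r)) exchange
      shape : ∀ r → i p∈I ++ output (ρ ++ᴿ loop r ++ᴿ τ) ++ t q∈F
              ≡ (i p∈I ++ output ρ ++ output (loop 0)) ++ proj₁ geo ^ r ++ (output τ ++ t q∈F)
      shape r = begin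
        i p∈I ++ output (ρ ++ᴿ loop r ++ᴿ τ) ++ t q∈F
          ≡⟨ unfold (loop r) ⟩
        (i p∈I ++ output ρ) ++ output (loop r) ++ (output τ ++ t q∈F)
          ≡⟨ cong (λ z → (i p∈I ++ output ρ) ++ z ++ (output τ ++ t q∈F)) (proj₂ geo r) ⟩
        (i p∈I ++ output ρ) ++ (output (loop 0) ++ proj₁ geo ^ r) ++ (output τ ++ t q∈F)
          ≡⟨ ++-assoc (i p∈I) _ _ ⟩
        i p∈I ++ output ρ ++ (output (loop 0) ++ proj₁ geo ^ r) ++ (output τ ++ t q∈F)
          ≡⟨ cong (λ z → i p∈I ++ output ρ ++ z) (++-assoc (output (loop 0)) _ _) ⟩
        i p∈I ++ output ρ ++ output (loop 0) ++ proj₁ geo ^ r ++ (output τ ++ t q∈F)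
          ≡⟨ cong (i p∈I ++_) (++-assoc (output ρ) _ _) ⟨
        i p∈I ++ (output ρ ++ output (loop 0)) ++ proj₁ geo ^ r ++ (output τ ++ t q∈F)
          ≡⟨ ++-assoc (i p∈I) _ _ ⟨
        (i p∈I ++ output ρ ++ output (loop 0)) ++ proj₁ geo ^ r ++ (output τ ++ t q∈F) ∎

    -- The position and length of the loop vary with `u`, `w`, `v`, but `a + c` is at most `m` and
    -- `n * suc b` at most `n * m`. The surplus `d` up to the uniform exponent `M` is absorbed into
    -- `α`.
    reindex : ∀ {m M a b c} u w v → m + n * m ≤ M → a + suc b + c ≡ m →
      (∃[ α ] ∃[ β ] ∃[ γ ] ∀ t →
        Realized ((u ++ w ^ a) ++ w ^ (n * suc b + t) ++ (w ^ c ++ v)) (α ++ β ^ t ++ γ)) →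
      ∃[ α ] ∃[ β ] ∃[ γ ] ∀ r → Realized (u ++ w ^ (M + r) ++ v) (α ++ β ^ r ++ γ)
    reindex {m} {M} {a} {b} {c} u w v thr≤M eq (α , β , γ , real′) = α ++ β ^ d , β , γ , λ r →
      subst₂ Realized (word r) (value r) (real′ (d + r))
      where
      open ≡-Reasoning
      e = n * suc b
      small : a + e + c ≤ M
      small = ≤-trans (≤-reflexive (trans (+-assoc a e c) (trans (cong (a +_) (+-comm e c)) (sym (+-assoc a c e)))))
        (≤-trans (+-mono-≤
          (≤-trans (+-monoˡ-≤ c (m≤m+n a (suc b))) (≤-reflexive eq))
          (*-monoʳ-≤ n (≤-trans (m≤n+m (suc b) a) (≤-trans (m≤m+n _ c) (≤-reflexive eq))))) thr≤M)
      d = M ∸ (a + e + c)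
      rearrange : ∀ a e c d r → a + ((e + (d + r)) + c) ≡ (d + (a + e + c)) + r
      rearrange = solve-∀
      word : ∀ r → (u ++ w ^ a) ++ w ^ (e + (d + r)) ++ (w ^ c ++ v) ≡ u ++ w ^ (M + r) ++ v
      word r = begin
        (u ++ w ^ a) ++ w ^ (e + (d + r)) ++ (w ^ c ++ v)   ≡⟨ ++-assoc u _ _ ⟩
        u ++ w ^ a ++ w ^ (e + (d + r)) ++ (w ^ c ++ v)     ≡⟨ cong (λ z → u ++ w ^ a ++ z) (++-assoc (w ^ (e + (d + r))) _ v) ⟨
        u ++ w ^ a ++ (w ^ (e + (d + r)) ++ w ^ c) ++ v     ≡⟨ cong (u ++_) (++-assoc (w ^ a) _ v) ⟨
        u ++ (w ^ a ++ w ^ (e + (d + r)) ++ w ^ c) ++ v     ≡⟨ cong (λ z → u ++ (w ^ a ++ z) ++ v) (^-+ w (e + (d + r)) c) ⟨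
        u ++ (w ^ a ++ w ^ (e + (d + r) + c)) ++ v          ≡⟨ cong (λ z → u ++ z ++ v) (^-+ w a _) ⟨
        u ++ w ^ (a + (e + (d + r) + c)) ++ v               ≡⟨ cong (λ z → u ++ w ^ z ++ v) (trans (rearrange a e c d r) (cong (_+ r) (m∸n+n≡m small))) ⟩
        u ++ w ^ (M + r) ++ v                               ∎
      value : ∀ r → α ++ β ^ (d + r) ++ γ ≡ (α ++ β ^ d) ++ β ^ r ++ γ
      value r = begin
        α ++ β ^ (d + r) ++ γ         ≡⟨ cong (λ z → α ++ z ++ γ) (^-+ β d r) ⟩
        α ++ (β ^ d ++ β ^ r) ++ γ    ≡⟨ cong (α ++_) (++-assoc (β ^ d) _ γ) ⟩
        α ++ β ^ d ++ β ^ r ++ γ      ≡⟨ ++-assoc α _ _ ⟨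
        (α ++ β ^ d) ++ β ^ r ++ γ    ∎

    -- The exponent is first lowered from `M` to `m`, so that the loop found has its parameters
    -- bounded by `m`; this is why the threshold on `M` does not depend on the words.
    pumping : ∀ {m M} → size ≤ m → n ≤ m → m + n * m ≤ M → ∀ u w v {y} →
              Realized (u ++ w ^ M ++ v) y →
              ∃[ α ] ∃[ β ] ∃[ γ ] ∀ r → Realized (u ++ w ^ (M + r) ++ v) (α ++ β ^ r ++ γ)
    pumping {m} {M} size≤m n≤m thr≤M u w v real
      with domain-stable u w v {M} {m} (≤-trans n≤m (≤-trans (m≤m+n m _) thr≤M)) n≤m real
    ... | _ , p , q , p∈I , ρ , q∈F , _ with splitᴿ u ρ
    ... | _ , ρ₁ , ρ₂ with splitᴿ (w ^ m) ρ₂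
    ... | _ , ρ₃ , ρ₄ with find-loop m size≤m ρ₃
    ... | s , a , b , c , eq , σ₁ , σ₂ , σ₃ =
      reindex {a = a} {b} {c} u w v thr≤M eq (loops {w} {b = b} p∈I (ρ₁ ++ᴿ σ₁) σ₂ (σ₃ ++ᴿ ρ₄) q∈F)

-- Reachability in finite graphs

anyWord? : ∀ n {P : Word k → Set} → Decidable P → Dec (∃[ w ] length w ≤ n × P w)
anyWord? zero    P? = map′ (λ p → [] , z≤n , p) (λ { ([] , _ , p) → p }) (P? [])
anyWord? (suc n) P? = map′
  (λ { (inj₁ p) → [] , z≤n , p ; (inj₂ (a , w , l , p)) → a ∷ w , s≤s l , p })
  (λ { ([] , _ , p) → inj₁ p ; (a ∷ w , s≤s l , p) → inj₂ (a , w , l , p) })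
  (P? [] ⊎-dec Fin.any? (λ a → anyWord? n (λ w → P? (a ∷ w))))

-- Vertices come with an injection into `Fin n` so that the search covers pairs of states as well as
-- single states.
module Reachability {S : Set} {n} (code : S → Fin n) (code-injective : ∀ {s t} → code s ≡ code t → s ≡ t)
                    (step : S → Fin k → S) where

  step* : S → Word k → S
  step* s []      = s
  step* s (a ∷ w) = step* (step s a) w

  step*-++ : ∀ s u v → step* s (u ++ v) ≡ step* (step* s u) v
  step*-++ s []      v = refl
  step*-++ s (a ∷ u) v = step*-++ (step s a) u v

  -- A word longer than `n` passes through some vertex twice; the factor read in between is cut out
  -- and the argument repeated.
  shorten : ∀ s w → Acc _<_ (length w) → ∃[ w′ ] length w′ ≤ n × step* s w′ ≡ step* s w
  shorten s w (acc rs) with length w ≤? n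
  ... | yes short = w , short , refl
  ... | no  long with Fin.pigeonhole (≰⇒> long) (λ i → code (step* s (take (toℕ i) w)))
  ... | i , j , i<j , same
    with shorten s (take (toℕ i) w ++ drop (toℕ j) w) (rs shorter)
    where
    open ≤-Reasoning
    shorter : length (take (toℕ i) w ++ drop (toℕ j) w) < length w
    shorter = begin-strict
      length (take (toℕ i) w ++ drop (toℕ j) w)           ≡⟨ length-++ (take (toℕ i) w) ⟩
      length (take (toℕ i) w) + length (drop (toℕ j) w)   ≡⟨ cong₂ _+_ (length-take (toℕ i) w) (length-drop (toℕ j) w) ⟩
      _                                                   ≤⟨ +-monoˡ-≤ _ (m⊓n≤m (toℕ i) (length w)) ⟩
      toℕ i + (length w ∸ toℕ j)                          <⟨ +-monoˡ-< _ i<j ⟩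
      toℕ j + (length w ∸ toℕ j)                          ≡⟨ m+[n∸m]≡n (<⇒≤ (Fin.toℕ<n j)) ⟩
      length w                                            ∎
  ... | w′ , short , eq = w′ , short , trans eq (begin
      step* s (take (toℕ i) w ++ drop (toℕ j) w)            ≡⟨ step*-++ s (take (toℕ i) w) _ ⟩
      step* (step* s (take (toℕ i) w)) (drop (toℕ j) w)     ≡⟨ cong (λ z → step* z (drop (toℕ j) w)) (code-injective same) ⟩
      step* (step* s (take (toℕ j) w)) (drop (toℕ j) w)     ≡⟨ step*-++ s (take (toℕ j) w) _ ⟨
      step* s (take (toℕ j) w ++ drop (toℕ j) w)            ≡⟨ cong (step* s) (take++drop≡id (toℕ j) w) ⟩
      step* s w                                             ∎)
    where open ≡-Reasoning

  reachable? : ∀ {P : S → Set} → Decidable P → ∀ s → Dec (∃[ w ] P (step* s w))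
  reachable? {P} P? s = map′ (λ (w , _ , p) → w , p) to-short (anyWord? n (λ w → P? (step* s w)))
    where
    to-short : ∃[ w ] P (step* s w) → ∃[ w ] length w ≤ n × P (step* s w)
    to-short (w , p) with shorten s w (<-wellFounded _)
    ... | w′ , short , eq = w′ , short , subst P (sym eq) p

-- Searching and summing over finite sets

first : ∀ {n} → (Fin n → Bool) → Maybe (Fin n)
first {zero}  b = nothing
first {suc n} b = if b zero then just zero else Maybe.map suc (first (b ∘ suc))

-- This makes the choice canonical: equivalent states, having the same candidates, receive the same
-- representative.
first-cong : ∀ {n} {b c : Fin n → Bool} → b ≗ c → first b ≡ first c
first-cong {zero}  e = refl
first-cong {suc n} e =
  cong₂ (λ x y → if x then just zero else Maybe.map suc y) (e zero) (first-cong (e ∘ suc))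

first-sound : ∀ {n} (b : Fin n → Bool) {i} → b i ≡ true → ∃[ j ] first b ≡ just j × b j ≡ true
first-sound {suc n} b {i} bi with b zero in eq
... | true = zero , refl , eq
first-sound {suc n} b {zero}  bi | false = contradiction (trans (sym bi) eq) λ ()
first-sound {suc n} b {suc i} bi | false with first-sound (b ∘ suc) {i} bi
... | j , fj , bj = suc j , cong (Maybe.map suc) fj , bj

-- Applied to word lengths, the termination measure of `tighten`.
total : ∀ {n} → (Fin n → ℕ) → ℕ
total {zero}  f = 0
total {suc n} f = f zero + total (f ∘ suc)

total-mono-≤ : ∀ {n} {f g : Fin n → ℕ} → (∀ i → f i ≤ g i) → total f ≤ total g
total-mono-≤ {zero}  le = z≤n
total-mono-≤ {suc n} le = +-mono-≤ (le zero) (total-mono-≤ (le ∘ suc))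

total-mono-< : ∀ {n} {f g : Fin n → ℕ} → (∀ i → f i ≤ g i) → ∀ i → f i < g i → total f < total g
total-mono-< le zero    lt = +-mono-<-≤ lt (total-mono-≤ (le ∘ suc))
total-mono-< le (suc i) lt = +-mono-≤-< (le zero) (total-mono-< (le ∘ suc) i lt)

-- Longest common prefixes

infix 4 _≼_
_≼_ : Word k → Word k → Set
x ≼ y = ∃[ d ] y ≡ x ++ d

_≼?_ : (x y : Word k) → Dec (x ≼ y)
[]      ≼? y  = yes (y , refl)
(a ∷ x) ≼? [] = no λ ()
(a ∷ x) ≼? (b ∷ y) = map′
  (λ { (refl , d , e) → d , cong (a ∷_) e })
  (λ { (d , e) → sym (∷-injectiveˡ e) , d , ∷-injectiveʳ e })
  (a Fin.≟ b ×-dec x ≼? y)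

≼-trans : {x y z : Word k} → x ≼ y → y ≼ z → x ≼ z
≼-trans {x = x} (d , refl) (e , refl) = d ++ e , ++-assoc x d e

≼-++ʳ : {x y : Word k} (z : Word k) → x ≼ y → x ≼ y ++ z
≼-++ʳ {x = x} z (d , refl) = d ++ z , ++-assoc x d z

≼-++ˡ : (z : Word k) {x y : Word k} → x ≼ y → z ++ x ≼ z ++ y
≼-++ˡ z {x} (d , refl) = d , sym (++-assoc z x d)

≼-cancelˡ : (z : Word k) {x y : Word k} → z ++ x ≼ z ++ y → x ≼ y
≼-cancelˡ z {x} {y} (d , e) = d , ++-cancelˡ z y (x ++ d) (trans e (++-assoc z x d))

≼-comparable : {x y z : Word k} → x ≼ z → y ≼ z → length x ≤ length y → x ≼ y
≼-comparable {x = x} {y} (d , refl) (e , eq) le with ++-overlap x y eq le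
... | c , p , _ = c , p

≼-drop : {x y : Word k} → x ≼ y → x ++ drop (length x) y ≡ y
≼-drop {x = []}    _          = refl
≼-drop {x = a ∷ x} (d , refl) = cong (a ∷_) (≼-drop {x = x} (d , refl))

lcp : Word k → Word k → Word k
lcp []      y       = []
lcp (a ∷ x) []      = []
lcp (a ∷ x) (b ∷ y) with a Fin.≟ b
... | yes _ = a ∷ lcp x y
... | no  _ = []

lcp-≼ˡ : (x y : Word k) → lcp x y ≼ x
lcp-≼ˡ []      y  = [] , refl
lcp-≼ˡ (a ∷ x) [] = a ∷ x , refl
lcp-≼ˡ (a ∷ x) (b ∷ y) with a Fin.≟ b
... | yes _ = proj₁ (lcp-≼ˡ x y) , cong (a ∷_) (proj₂ (lcp-≼ˡ x y))
... | no  _ = a ∷ x , refl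

lcp-≼ʳ : (x y : Word k) → lcp x y ≼ y
lcp-≼ʳ []      y  = y , refl
lcp-≼ʳ (a ∷ x) [] = [] , refl
lcp-≼ʳ (a ∷ x) (b ∷ y) with a Fin.≟ b
... | yes refl = proj₁ (lcp-≼ʳ x y) , cong (a ∷_) (proj₂ (lcp-≼ʳ x y))
... | no  _    = b ∷ y , refl

lcp-greatest : (z x y : Word k) → z ≼ x → z ≼ y → z ≼ lcp x y
lcp-greatest []      x y _ _ = lcp x y , refl
lcp-greatest (c ∷ z) x y (d , refl) (e , refl) with c Fin.≟ c
... | yes _   = ≼-++ˡ (c ∷ []) (lcp-greatest z (z ++ d) (z ++ e) (d , refl) (e , refl))
... | no  c≢c = contradiction refl c≢c

lcp-shorter : (x y : Word k) → ¬ (x ≼ y) → length (lcp x y) < length x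
lcp-shorter x y x⋠y with lcp-≼ˡ x y
... | [] , e = contradiction (subst (_≼ y) (sym (trans e (++-identityʳ _))) (lcp-≼ʳ x y)) x⋠y
... | a ∷ d , e = subst (length (lcp x y) <_) (sym (trans (cong length e) (length-++ (lcp x y))))
                        (m<m+n _ (s≤s z≤n))

-- Sequential machines

-- A complete deterministic transducer. Partiality lies in `fin` alone, and `residual p` is the
-- partial function computed from state `p`.
record Machine (k : ℕ) : Set where
  field
    states : ℕ
    δ      : Fin states → Fin k → Fin states
    out    : Fin states → Fin k → Word k
    fin    : Fin states → Maybe (Word k)
    q₀     : Fin states
    ι      : Word k

  δ* : Fin states → Word k → Fin states
  δ* p []      = p
  δ* p (a ∷ w) = δ* (δ p a) w

  out* : Fin states → Word k → Word k
  out* p []      = []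
  out* p (a ∷ w) = out p a ++ out* (δ p a) w

  residual : Fin states → Word k → Maybe (Word k)
  residual p []      = fin p
  residual p (a ∷ w) = Maybe.map (out p a ++_) (residual (δ p a) w)

  ⟦_⟧ : Word k → Maybe (Word k)
  ⟦ w ⟧ = Maybe.map (ι ++_) (residual q₀ w)

  Live : Fin states → Set
  Live p = ∃[ v ] ∃[ y ] residual p v ≡ just y

  Accessible : Fin states → Set
  Accessible p = ∃[ w ] δ* q₀ w ≡ p

  infix 4 _≈_
  _≈_ : Fin states → Fin states → Set
  p ≈ r = residual p ≗ residual r

  LowerBound : Fin states → Word k → Set
  LowerBound p x = ∀ v y → residual p v ≡ just y → x ≼ y

  -- The onward, or earliest, normal form. `dead-silent` fixes the outputs into dead states, about
  -- which `no-common-prefix` says nothing; together they make letter outputs invariant under `≈`.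
  record Reduced : Set where
    field
      no-common-prefix : ∀ p x → Live p → LowerBound p x → x ≡ []
      dead-silent      : ∀ p a → ¬ Live (δ p a) → out p a ≡ []

map-++ : ∀ (x y : Word k) m → Maybe.map (x ++_) (Maybe.map (y ++_) m) ≡ Maybe.map ((x ++ y) ++_) m
map-++ x y (just z) = cong just (sym (++-assoc x y z))
map-++ x y nothing  = refl

map-just : ∀ (x : Word k) m {y} → Maybe.map (x ++_) m ≡ just y → ∃[ z ] m ≡ just z × y ≡ x ++ z
map-just x (just z) refl = z , refl , refl

map-injective : ∀ (x : Word k) {m n} → Maybe.map (x ++_) m ≡ Maybe.map (x ++_) n → m ≡ n
map-injective x = Maybe.map-injective (++-cancelˡ x _ _)

module MachineProperties (M : Machine k) where
  open Machine M

  δ*-++ : ∀ p u v → δ* p (u ++ v) ≡ δ* (δ* p u) v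
  δ*-++ p []      v = refl
  δ*-++ p (a ∷ u) v = δ*-++ (δ p a) u v

  residual-++ : ∀ p u v → residual p (u ++ v) ≡ Maybe.map (out* p u ++_) (residual (δ* p u) v)
  residual-++ p []      v = sym (Maybe.map-id _)
  residual-++ p (a ∷ u) v =
    trans (cong (Maybe.map (out p a ++_)) (residual-++ (δ p a) u v)) 
      (map-++ (out p a) (out* (δ p a) u) (residual (δ* (δ p a) u) v))

  out*-++ : ∀ p u v → out* p (u ++ v) ≡ out* p u ++ out* (δ* p u) v
  out*-++ p []      v = refl
  out*-++ p (a ∷ u) v = trans (cong (out p a ++_) (out*-++ (δ p a) u v)) (sym (++-assoc (out p a) _ _))

  residual-fin : ∀ p v → residual p v ≡ Maybe.map (out* p v ++_) (fin (δ* p v))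
  residual-fin p v = trans (cong (residual p) (sym (++-identityʳ v))) (residual-++ p v [])

  open Reachability {S = Fin states} (λ p → p) (λ e → e) δ

  δ*≡step* : ∀ p w → δ* p w ≡ step* p w
  δ*≡step* p []      = refl
  δ*≡step* p (a ∷ w) = δ*≡step* (δ p a) w

  accessible? : Decidable Accessible
  accessible? p = map′ (λ (w , e) → w , trans (δ*≡step* q₀ w) e) (λ (w , e) → w , trans (sym (δ*≡step* q₀ w)) e)
                       (reachable? (Fin._≟ p) q₀)

  live? : Decidable Live
  live? p = map′ to-live from-live (reachable? final? p)
    where
    final? : Decidable (λ p → ∃[ t ] fin p ≡ just t)
    final? p with fin p
    ... | just t  = yes (t , refl)
    ... | nothing = no λ ()
    to-live : ∃[ w ] (∃[ t ] fin (step* p w) ≡ just t) → Live p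
    to-live (w , t , e) = w , _ ,
      trans (residual-fin p w) (cong (Maybe.map (out* p w ++_)) (trans (cong fin (δ*≡step* p w)) e))
    from-live : Live p → ∃[ w ] (∃[ t ] fin (step* p w) ≡ just t)
    from-live (v , y , e) with map-just (out* p v) _ (trans (sym (residual-fin p v)) e)
    ... | t , e′ , _ = v , t , trans (cong fin (sym (δ*≡step* p v))) e′

  dead⇒nothing : ∀ p → ¬ Live p → ∀ v → residual p v ≡ nothing
  dead⇒nothing p dead v with residual p v in e
  ... | nothing = refl
  ... | just y  = contradiction (v , y , e) dead

  -- Longest common prefixes of the outputs from each state

  Upper : (Fin states → Word k) → Set
  Upper L = ∀ p x → Live p → LowerBound p x → x ≼ L p

  module _ (L : Fin states → Word k) where
    FinalViolation : Fin states → Set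
    FinalViolation p = ∃[ t ] fin p ≡ just t × ¬ (L p ≼ t)

    -- Only live successors are tested, because a dead one contributes no output that `L p` would
    -- have to precede.
    StepViolation : Fin states → Fin k → Set
    StepViolation p a = Live (δ p a) × ¬ (L p ≼ out p a ++ L (δ p a))

    violation? : Dec (∃[ p ] (FinalViolation p ⊎ ∃[ a ] StepViolation p a))
    violation? = Fin.any? λ p → final? p ⊎-dec
      Fin.any? λ a → live? (δ p a) ×-dec ¬? (L p ≼? (out p a ++ L (δ p a)))
      where
      final? : Decidable FinalViolation
      final? p with fin p
      ... | nothing = no λ ()
      ... | just t with L p ≼? t
      ...   | yes below = no λ { (_ , refl , ¬below) → ¬below below }
      ...   | no ¬below = yes (t , refl , ¬below)

    consistent⇒lower : ¬ (∃[ p ] (FinalViolation p ⊎ ∃[ a ] StepViolation p a)) →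
                       ∀ p → LowerBound p (L p)
    consistent⇒lower ok p []      t e = decidable-stable (L p ≼? t) λ ¬below → ok (p , inj₁ (t , e , ¬below))
    consistent⇒lower ok p (a ∷ v) y e with map-just (out p a) _ e
    ... | z , e′ , refl = ≼-trans
      (decidable-stable (L p ≼? _) λ ¬below → ok (p , inj₂ (a , (v , z , e′) , ¬below)))
      (≼-++ˡ (out p a) (consistent⇒lower ok (δ p a) v z e′))

    -- Either `x` is already a prefix of `out p a`, or it is `out p a` followed by some `d`; in the
    -- latter case `d` is a lower bound at `δ p a`, hence a prefix of `L (δ p a)`.
    upper-step : Upper L → ∀ p a x → Live (δ p a) → LowerBound p x → x ≼ out p a ++ L (δ p a)
    upper-step upper p a x live@(v , y , e) low
      with ≤-total (length x) (length (out p a))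
    ... | inj₁ le = ≼-++ʳ _ (≼-comparable (low (a ∷ v) _ (cong (Maybe.map (out p a ++_)) e)) (y , refl) le)
    ... | inj₂ ge with ≼-comparable (y , refl) (low (a ∷ v) _ (cong (Maybe.map (out p a ++_)) e)) ge
    ... | d , refl = ≼-++ˡ (out p a) (upper (δ p a) d live λ v y e →
      ≼-cancelˡ (out p a) (low (a ∷ v) _ (cong (Maybe.map (out p a ++_)) e)))

    module _ (p : Fin states) (y : Word k) where
      cut : Fin states → Word k
      cut q with q Fin.≟ p
      ... | yes _ = lcp (L q) y
      ... | no  _ = L q

      cut-upper : Upper L → (∀ x → LowerBound p x → x ≼ y) → Upper cut
      cut-upper upper below q x live low with q Fin.≟ p
      ... | yes refl = lcp-greatest x (L q) y (upper q x live low) (below x low)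
      ... | no  _    = upper q x live low


      cut-total : ¬ (L p ≼ y) → total (length ∘ cut) < total (length ∘ L)
      cut-total ¬below = total-mono-< shrinks p strict
        where
        shrinks : ∀ q → length (cut q) ≤ length (L q)
        shrinks q with q Fin.≟ p
        ... | no  _ = ≤-refl
        ... | yes _ = let d , e = lcp-≼ˡ (L q) y in
          subst (length (lcp (L q) y) ≤_) (sym (trans (cong length e) (length-++ (lcp (L q) y)))) (m≤m+n _ _)
        strict : length (cut p) < length (L p)
        strict with p Fin.≟ p
        ... | yes _   = lcp-shorter (L p) y ¬below
        ... | no  p≢p = contradiction refl p≢p

  -- A violation at `p` exhibits a word that every lower bound at `p` precedes but `L p` does not.
  -- Cutting `L p` to the common prefix with that word keeps `Upper` and lowers the total length.
  -- Without violations, `L` consists of lower bounds by induction on the input.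
  tighten : ∀ L → Upper L → Acc _<_ (total (length ∘ L)) →
            ∃[ L′ ] Upper L′ × (∀ p → LowerBound p (L′ p))
  tighten L upper (acc rs) with violation? L
  ... | no  consistent = L , upper , consistent⇒lower L consistent
  ... | yes (p , inj₁ (t , e , ¬below)) =
    tighten (cut L p t) (cut-upper L p t upper (λ x low → low [] t e)) (rs (cut-total L p t ¬below))
  ... | yes (p , inj₂ (a , live , ¬below)) =
    tighten (cut L p y) (cut-upper L p y upper (λ x → upper-step L upper p a x live))
            (rs (cut-total L p y ¬below))
    where y = out p a ++ L (δ p a)

  -- The descent starts from any one output of each live state, which all lower bounds there
  -- precede; dead states start from the empty word.
  greatest-lower-bounds : ∃[ L ] Upper L × (∀ p → LowerBound p (L p))
  greatest-lower-bounds = tighten (λ p → some p (live? p)) (λ p x live → upper p x live (live? p)) (<-wellFounded _)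
    where
    some : ∀ p → Dec (Live p) → Word k
    some p (yes (_ , y , _)) = y
    some p (no  _)           = []
    upper : ∀ p x → Live p → ∀ live?p → LowerBound p x → x ≼ some p live?p
    upper p x live (yes (v , y , e)) low = low v y e
    upper p x live (no  dead)        low = contradiction live dead

-- L p is the longest common prefix of the outputs from p; emitting it on the way into p makes
-- every output occur as early as possible.
module Push (M : Machine k) where
  open Machine M
  open MachineProperties M

  L = proj₁ greatest-lower-bounds
  upper = proj₁ (proj₂ greatest-lower-bounds)
  lower = proj₂ (proj₂ greatest-lower-bounds)

  -- For a live successor `L p` is a prefix of the word it is dropped from, by `upper-step`, so this
  -- is `(L p)⁻¹ (out p a) (L (δ p a))` in the free group. Along a run the factors `L` telescope.
  pushed-out : ∀ p a → Dec (Live (δ p a)) → Word k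
  pushed-out p a (yes _) = drop (length (L p)) (out p a ++ L (δ p a))
  pushed-out p a (no  _) = []

  pushed : Machine k
  pushed = record
    { states = states
    ; δ      = δ
    ; out    = λ p a → pushed-out p a (live? (δ p a))
    ; fin    = λ p → Maybe.map (drop (length (L p))) (fin p)
    ; q₀     = q₀
    ; ι      = ι ++ L q₀
    }

  private module P = Machine pushed

  residual-pushed : ∀ p v → residual p v ≡ Maybe.map (L p ++_) (P.residual p v)
  residual-pushed p [] with fin p in eq
  ... | nothing = refl
  ... | just t  = cong just (sym (≼-drop (lower p [] t eq)))
  residual-pushed p (a ∷ v) with live? (δ p a)
  ... | no dead = begin
    Maybe.map (out p a ++_) (residual (δ p a) v)                 ≡⟨ cong (Maybe.map _) (dead⇒nothing (δ p a) dead v) ⟩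
    nothing                                                      ≡⟨ cong (Maybe.map (L p ++_) ∘ Maybe.map ([] ++_)) silent ⟨
    Maybe.map (L p ++_) (Maybe.map ([] ++_) (P.residual (δ p a) v)) ∎
    where
    open ≡-Reasoning
    silent : P.residual (δ p a) v ≡ nothing
    silent = map-injective (L (δ p a)) (trans (sym (residual-pushed (δ p a) v)) (dead⇒nothing (δ p a) dead v))
  ... | yes live = begin
    Maybe.map (out p a ++_) (residual (δ p a) v)
      ≡⟨ cong (Maybe.map (out p a ++_)) (residual-pushed (δ p a) v) ⟩
    Maybe.map (out p a ++_) (Maybe.map (L (δ p a) ++_) (P.residual (δ p a) v))
      ≡⟨ map-++ (out p a) (L (δ p a)) (P.residual (δ p a) v) ⟩
    Maybe.map ((out p a ++ L (δ p a)) ++_) (P.residual (δ p a) v)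
      ≡⟨ cong (λ z → Maybe.map (z ++_) (P.residual (δ p a) v))
              (≼-drop (upper-step L upper p a (L p) live (lower p))) ⟨
    Maybe.map ((L p ++ drop (length (L p)) (out p a ++ L (δ p a))) ++_) (P.residual (δ p a) v)
      ≡⟨ map-++ (L p) _ (P.residual (δ p a) v) ⟨
    Maybe.map (L p ++_) (Maybe.map (drop (length (L p)) (out p a ++ L (δ p a)) ++_) (P.residual (δ p a) v)) ∎
    where open ≡-Reasoning

  ⟦pushed⟧ : ∀ v → ⟦ v ⟧ ≡ P.⟦ v ⟧
  ⟦pushed⟧ v = trans (cong (Maybe.map (ι ++_)) (residual-pushed q₀ v)) (map-++ ι (L q₀) (P.residual q₀ v))

  live-pushed : ∀ p → P.Live p → Live p
  live-pushed p (v , y , e) = v , L p ++ y , trans (residual-pushed p v) (cong (Maybe.map (L p ++_)) e)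

  pushed-live : ∀ p → Live p → P.Live p
  pushed-live p (v , y , e) with map-just (L p) _ (trans (sym (residual-pushed p v)) e)
  ... | z , e′ , _ = v , z , e′

  pushed-reduced : P.Reduced
  pushed-reduced = record { no-common-prefix = no-common-prefix ; dead-silent = dead-silent }
    where
    no-common-prefix : ∀ p x → P.Live p → P.LowerBound p x → x ≡ []
    no-common-prefix p x live low
      -- `L p ++ x` is a lower bound in the original machine, hence a prefix of `L p`, which leaves
      -- no room for `x`.
      with upper p (L p ++ x) (live-pushed p live) low′
      where
      low′ : LowerBound p (L p ++ x)
      low′ v y e with map-just (L p) _ (trans (sym (residual-pushed p v)) e)
      ... | z , e′ , refl = ≼-++ˡ (L p) (low v z e′)
    ... | d , e = ++-conicalˡ x d (++-identityʳ-unique (L p) (trans e (++-assoc (L p) x d)))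
    dead-silent : ∀ p a → ¬ P.Live (δ p a) → pushed-out p a (live? (δ p a)) ≡ []
    dead-silent p a dead with live? (δ p a)
    ... | yes live = contradiction (pushed-live (δ p a) live) dead
    ... | no  _    = refl

-- Merging equivalent accessible states of a reduced machine

module Quotient (M : Machine k) (reduced : Machine.Reduced M) where
  open Machine M
  open MachineProperties M
  open Reduced reduced

  private
    -- Here `y = x ++ d`, and cancelling `x` shows that `d` precedes every output from `p`;
    -- reducedness makes `d` empty.
    synchronise-≤ : ∀ {p r} x y → length x ≤ length y → Live p →
      (∀ v → Maybe.map (x ++_) (residual p v) ≡ Maybe.map (y ++_) (residual r v)) → x ≡ y
    synchronise-≤ {p} {r} x y x≤y live@(v , s , e) same
      with map-just y (residual r v) (trans (sym (same v)) (cong (Maybe.map (x ++_)) e))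
    ... | s′ , _ , xs≡ys′ with ++-overlap x y xs≡ys′ x≤y
    ... | d , refl , _ = sym (trans (cong (x ++_) (no-common-prefix p d live low)) (++-identityʳ x))
      where
      low : LowerBound p d
      low v s e with map-just (x ++ d) (residual r v) (trans (sym (same v)) (cong (Maybe.map (x ++_)) e))
      ... | s′ , _ , xs≡ = s′ , ++-cancelˡ x s (d ++ s′) (trans xs≡ (++-assoc x d s′))

  synchronise : ∀ {p r} x y → Live p →
    (∀ v → Maybe.map (x ++_) (residual p v) ≡ Maybe.map (y ++_) (residual r v)) → x ≡ y
  synchronise {p} {r} x y live@(v , s , e) same with ≤-total (length x) (length y)
  ... | inj₁ le = synchronise-≤ x y le live same
  ... | inj₂ ge = sym (synchronise-≤ y x ge live′ (λ v → sym (same v)))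
    where
    live′ : Live r
    live′ with map-just y (residual r v) (trans (sym (same v)) (cong (Maybe.map (x ++_)) e))
    ... | s′ , e′ , _ = v , s′ , e′

  -- This is the use of the reduced form: residuals that agree up to left factors independent of the
  -- input are equal.
  synchronise-≈ : ∀ {p r} x y → Live p →
    (∀ v → Maybe.map (x ++_) (residual p v) ≡ Maybe.map (y ++_) (residual r v)) → p ≈ r
  synchronise-≈ {p} {r} x y live same v with synchronise {p} {r} x y live same
  ... | refl = map-injective x (same v)

  ≈-sym : ∀ {p r} → p ≈ r → r ≈ p
  ≈-sym e v = sym (e v)

  ≈-trans : ∀ {p q r} → p ≈ q → q ≈ r → p ≈ r
  ≈-trans e f v = trans (e v) (f v)

  ≈-out : ∀ {p r} → p ≈ r → ∀ a → out p a ≡ out r a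
  ≈-out {p} {r} e a with live? (δ p a)
  ... | yes live = synchronise {δ p a} {δ r a} _ _ live (λ v → e (a ∷ v))
  ... | no dead  = trans (dead-silent p a dead) (sym (dead-silent r a dead′))
    where
    dead′ : ¬ Live (δ r a)
    dead′ (v , s , live) with map-just (out p a) _ (trans (e (a ∷ v)) (cong (Maybe.map (out r a ++_)) live))
    ... | s′ , e′ , _ = dead (v , s′ , e′)

  ≈-δ : ∀ {p r} → p ≈ r → ∀ a → δ p a ≈ δ r a
  ≈-δ {p} {r} e a v = map-injective (out p a)
    (trans (e (a ∷ v)) (cong (λ z → Maybe.map (z ++_) (residual (δ r a) v)) (sym (≈-out {p} {r} e a))))

  private
    Pair = Fin states × Fin states

    Agree : Pair → Set
    Agree (p , r) = fin p ≡ fin r × (∀ a → out p a ≡ out r a)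

    agree? : Decidable Agree
    agree? (p , r) = Maybe.≡-dec (≡-dec Fin._≟_) (fin p) (fin r)
      ×-dec Fin.all? (λ a → ≡-dec Fin._≟_ (out p a) (out r a))

    code : Pair → Fin (states * states)
    code (p , r) = Fin.combine p r

    code-injective : ∀ {s t} → code s ≡ code t → s ≡ t
    code-injective {p , r} {p′ , r′} e with Fin.combine-injective p r p′ r′ e
    ... | refl , refl = refl

    open Reachability code code-injective (λ (p , r) a → δ p a , δ r a)

    ≈⇒agree : ∀ p r → p ≈ r → ∀ w → Agree (step* (p , r) w)
    ≈⇒agree p r e []      = e [] , ≈-out {p} {r} e
    ≈⇒agree p r e (a ∷ w) = ≈⇒agree (δ p a) (δ r a) (≈-δ {p} {r} e a) w

    agree⇒≈ : ∀ p r → (∀ w → Agree (step* (p , r) w)) → p ≈ r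
    agree⇒≈ p r e []      = proj₁ (e [])
    agree⇒≈ p r e (a ∷ v) = cong₂ (λ x → Maybe.map (x ++_)) (proj₂ (e []) a)
      (agree⇒≈ (δ p a) (δ r a) (λ w → e (a ∷ w)) v)

  -- Equivalence fails exactly when some pair reachable from `(p , r)` in the product graph differs
  -- in a final or letter output, which is a finite search. That equivalent states agree on letter
  -- outputs rests on reducedness, through `≈-out`.
  _≈?_ : ∀ p r → Dec (p ≈ r)
  p ≈? r with reachable? (λ s → ¬? (agree? s)) (p , r)
  ... | yes (w , differ) = no λ e → differ (≈⇒agree p r e w)
  ... | no  same = yes (agree⇒≈ p r λ w → decidable-stable (agree? _) λ differ → same (w , differ))

  Candidate : Fin states → Fin states → Set
  Candidate p r = Accessible r × p ≈ r

  candidate? : ∀ p → Decidable (Candidate p)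
  candidate? p r = accessible? r ×-dec p ≈? r

  -- An accessible `p` is its own candidate, so the search succeeds there; the default `p` is for
  -- inaccessible states.
  rep : Fin states → Fin states
  rep p = fromMaybe p (first (λ r → does (candidate? p r)))

  private
    first-candidate : ∀ p → Accessible p →
      ∃[ r ] first (λ r → does (candidate? p r)) ≡ just r × Candidate p r
    first-candidate p reach with first-sound (λ r → does (candidate? p r)) {p}
                                           (dec-true (candidate? p p) (reach , λ v → refl))
    ... | r , found , true? = r , found , does-true (candidate? p r) true?
      where
      does-true : ∀ {P : Set} (P? : Dec P) → does P? ≡ true → P
      does-true (yes p) _ = p

  rep-candidate : ∀ p → Accessible p → Candidate p (rep p)
  rep-candidate p reach with first-candidate p reach
  ... | r , found , cand = subst (Candidate p) (sym (cong (fromMaybe p) found)) cand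

  rep-cong : ∀ p q → Accessible p → p ≈ q → rep p ≡ rep q
  rep-cong p q reach p≈q with first-candidate p reach
  ... | r , found , _ = trans (cong (fromMaybe p) found) (sym (cong (fromMaybe q) (trans (sym same) found)))
    where
    same : first (λ r → does (candidate? p r)) ≡ first (λ r → does (candidate? q r))
    same = first-cong λ r → does-⇔ (mk⇔
      (λ (a , e) → a , ≈-trans {q} {p} {r} (≈-sym {p} {q} p≈q) e)
      (λ (a , e) → a , ≈-trans {p} {q} {r} p≈q e)) (candidate? p r) (candidate? q r)

  -- Inaccessible states loop on every letter, which keeps them aperiodic.
  quotient : Machine k
  quotient = record
    { states = states
    ; δ      = λ p a → if does (accessible? p) then rep (δ p a) else p
    ; out    = out
    ; fin    = fin
    ; q₀     = q₀
    ; ι      = ι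
    }

  private module Q = Machine quotient

  accessible-δ : ∀ {p} → Accessible p → ∀ a → Accessible (δ p a)
  accessible-δ (w , refl) a = w ++ a ∷ [] , δ*-++ q₀ w (a ∷ [])

  quotient-δ : ∀ {p} → Accessible p → ∀ a → Q.δ p a ≡ rep (δ p a)
  quotient-δ {p} reach a = cong (if_then rep (δ p a) else p) (dec-true (accessible? p) reach)

  quotient-δ-inaccessible : ∀ {p} → ¬ Accessible p → ∀ a → Q.δ p a ≡ p
  quotient-δ-inaccessible {p} reach a = cong (if_then rep (δ p a) else p) (dec-false (accessible? p) reach)

  quotient-residual : ∀ p → Accessible p → Q.residual p ≗ residual p
  quotient-residual p reach []      = refl
  quotient-residual p reach (a ∷ v) = cong (Maybe.map (out p a ++_)) (begin
    Q.residual (Q.δ p a) v       ≡⟨ cong (λ q → Q.residual q v) (quotient-δ reach a) ⟩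
    Q.residual (rep (δ p a)) v   ≡⟨ quotient-residual _ (proj₁ cand) v ⟩
    residual (rep (δ p a)) v     ≡⟨ proj₂ cand v ⟨
    residual (δ p a) v           ∎)
    where
    open ≡-Reasoning
    cand = rep-candidate (δ p a) (accessible-δ reach a)

  ⟦quotient⟧ : ∀ v → Q.⟦ v ⟧ ≡ ⟦ v ⟧
  ⟦quotient⟧ v = cong (Maybe.map (ι ++_)) (quotient-residual q₀ ([] , refl) v)

  quotient-δ*-rep : ∀ p → Accessible p → ∀ w → Q.δ* (rep p) w ≡ rep (δ* p w)
  quotient-δ*-rep p reach []      = refl
  quotient-δ*-rep p reach (a ∷ w) = begin
    Q.δ* (Q.δ (rep p) a) w     ≡⟨ cong (λ q → Q.δ* q w) (quotient-δ (proj₁ cand) a) ⟩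
    Q.δ* (rep (δ (rep p) a)) w ≡⟨ cong (λ q → Q.δ* q w) (rep-cong (δ p a) (δ (rep p) a) (accessible-δ reach a) (≈-δ {p} {rep p} (proj₂ cand) a)) ⟨
    Q.δ* (rep (δ p a)) w       ≡⟨ quotient-δ*-rep (δ p a) (accessible-δ reach a) w ⟩
    rep (δ* (δ p a) w)         ∎
    where
    open ≡-Reasoning
    cand = rep-candidate p reach

  accessible-δ* : ∀ {p} → Accessible p → ∀ w → Accessible (δ* p w)
  accessible-δ* (u , refl) w = u ++ w , δ*-++ q₀ u w

  -- The starting state need not be a representative, but every state after the first letter is one.
  -- Hence the positive exponents in `quotient-aperiodic`, where the empty `w` is treated apart.
  quotient-δ*-∷ : ∀ p → Accessible p → ∀ a w → Q.δ* p (a ∷ w) ≡ rep (δ* p (a ∷ w))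
  quotient-δ*-∷ p reach a w = trans (cong (λ q → Q.δ* q w) (quotient-δ reach a))
    (quotient-δ*-rep (δ p a) (accessible-δ reach a) w)

  quotient-δ*-inaccessible : ∀ p → ¬ Accessible p → ∀ w → Q.δ* p w ≡ p
  quotient-δ*-inaccessible p inacc []      = refl
  quotient-δ*-inaccessible p inacc (a ∷ w) =
    trans (cong (λ q → Q.δ* q w) (quotient-δ-inaccessible inacc a)) (quotient-δ*-inaccessible p inacc w)

  quotient-aperiodic : ∀ n → (∀ p → Accessible p → ∀ w → δ* p (w ^ suc n) ≈ δ* p (w ^ suc (suc n))) →
                       ∀ p w → Q.δ* p (w ^ suc n) ≡ Q.δ* p (w ^ suc (suc n))
  quotient-aperiodic n ap p w with accessible? p
  ... | no inacc = trans (quotient-δ*-inaccessible p inacc (w ^ suc n))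
                         (sym (quotient-δ*-inaccessible p inacc (w ^ suc (suc n))))
  quotient-aperiodic n ap p []         | yes _   = refl
  quotient-aperiodic n ap p w@(a ∷ w′) | yes reach = begin
    Q.δ* p (w ^ suc n)             ≡⟨ quotient-δ*-∷ p reach a (w′ ++ w ^ n) ⟩
    rep (δ* p (w ^ suc n))         ≡⟨ rep-cong _ _ (accessible-δ* reach (w ^ suc n)) (ap p reach w) ⟩
    rep (δ* p (w ^ suc (suc n)))   ≡⟨ quotient-δ*-∷ p reach a (w′ ++ w ^ suc n) ⟨
    Q.δ* p (w ^ suc (suc n))       ∎
    where open ≡-Reasoning

-- Translations between sequential transducers and machines

fin-subset : ∀ {n} {A : Set} → (Fin n → Maybe A) → Subset n
fin-subset f = Vec.tabulate (is-just ∘ f)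

module FromTransducer (T : Transducer k) (sequential : SequentialTransducer T) where
  open Transducer T
  q-init = proj₁ (proj₁ sequential)
  deterministic = proj₂ sequential

  q-init∈I : q-init ∈ I
  q-init∈I = subst (q-init ∈_) (sym (proj₂ (proj₁ sequential))) (x∈⁅x⁆ q-init)

  successor : ∀ p a → Dec (Nonempty (Δ p a)) → Fin (suc size) × Word k
  successor p a (yes (q , e)) = suc q , o e
  successor p a (no _)        = zero , []

  final : ∀ p → Dec (p ∈ F) → Maybe (Word k)
  final p (yes e) = just (t e)
  final p (no _)  = nothing

  -- State zero is a rejecting sink.
  machine : Machine k
  machine = record
    { states = suc size
    ; δ      = λ { zero a → zero ; (suc p) a → proj₁ (successor p a (nonempty? (Δ p a))) }
    ; out    = λ { zero a → [] ; (suc p) a → proj₂ (successor p a (nonempty? (Δ p a))) }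
    ; fin    = λ { zero → nothing ; (suc p) → final p (p ∈? F) }
    ; q₀     = suc q-init
    ; ι      = i q-init∈I
    }

  open Machine machine using (residual; ⟦_⟧)

  residual-sink : ∀ w → residual zero w ≡ nothing
  residual-sink []      = refl
  residual-sink (a ∷ w) = cong (Maybe.map _) (residual-sink w)

  run⇒residual : ∀ {p w q} (ρ : Run automaton p w q) (q∈F : q ∈ F) →
                 residual (suc p) w ≡ just (output ρ ++ t q∈F)
  run⇒residual {p} [] q∈F with p ∈? F
  ... | yes e  = cong (just ∘ t) ([]=-irrelevant e q∈F)
  ... | no p∉F = contradiction q∈F p∉F
  run⇒residual {p} {a ∷ w} (e ∷ ρ) q∈F with nonempty? (Δ p a)
  ... | no empty = contradiction (_ , e) empty
  ... | yes (q , e′) with deterministic p a e′ e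
  ... | refl with []=-irrelevant e′ e
  ... | refl = trans (cong (Maybe.map (o e ++_)) (run⇒residual ρ q∈F))
                     (cong just (sym (++-assoc (o e) (output ρ) (t q∈F))))

  residual⇒run : ∀ p w {y} → residual (suc p) w ≡ just y →
    ∃[ q ] Σ[ ρ ∈ Run automaton p w q ] Σ[ q∈F ∈ q ∈ F ] y ≡ output ρ ++ t q∈F
  residual⇒run p [] eq with p ∈? F | eq
  ... | yes e | refl = p , [] , e , refl
  residual⇒run p (a ∷ w) eq with nonempty? (Δ p a)
  ... | no _ = contradiction (trans (sym (cong (Maybe.map ([] ++_)) (residual-sink w))) eq) λ ()
  ... | yes (q , e) with map-just (o e) (residual (suc q) w) eq
  ... | z , eq′ , refl with residual⇒run q w eq′
  ... | r , ρ , r∈F , refl = r , e ∷ ρ , r∈F , sym (++-assoc (o e) (output ρ) (t r∈F))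

  machine-correct : ∀ u v → Realized u v ⇔ (⟦ u ⟧ ≡ just v)
  machine-correct u v = mk⇔ forward backward
    where
    forward : Realized u v → ⟦ u ⟧ ≡ just v
    forward (p , q , p∈I , ρ , q∈F , refl)
      with x∈⁅y⁆⇒x≡y q-init (subst (p ∈_) (proj₂ (proj₁ sequential)) p∈I)
    ... | refl with []=-irrelevant p∈I q-init∈I
    ... | refl = cong (Maybe.map (i q-init∈I ++_)) (run⇒residual ρ q∈F)
    backward : ⟦ u ⟧ ≡ just v → Realized u v
    backward eq with map-just (i q-init∈I) (residual (suc q-init) u) eq
    ... | z , eq′ , refl with residual⇒run q-init u eq′
    ... | q , ρ , q∈F , refl = q-init , q , q-init∈I , ρ , q∈F , refl

module ToTransducer (M : Machine k) where
  open Machine M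

  transducer : Transducer k
  transducer = record
    { automaton = record
      { size = states
      ; Δ    = λ p a → ⁅ δ p a ⁆
      ; I    = ⁅ q₀ ⁆
      ; F    = fin-subset fin
      }
    ; o = λ {p} {a} _ → out p a
    ; i = λ _ → ι
    -- Membership of `q` in `F` means that `fin q` is a `just`, so this is the machine's own final
    -- output, as `final-value` records.
    ; t = λ {q} _ → fromMaybe [] (fin q)
    }

  open Transducer transducer using (automaton; output; Realized; F; t)

  sequential : SequentialTransducer transducer
  sequential = (q₀ , refl) , λ p a q∈ r∈ → trans (x∈⁅y⁆⇒x≡y _ q∈) (sym (x∈⁅y⁆⇒x≡y _ r∈))

  run⇒δ* : ∀ {p w q} → Run automaton p w q → δ* p w ≡ q
  run⇒δ* [] = refl
  run⇒δ* {p} {a ∷ w} (e ∷ ρ) with x∈⁅y⁆⇒x≡y (δ p a) e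
  ... | refl = run⇒δ* ρ

  δ*-run : ∀ p w → Run automaton p w (δ* p w)
  δ*-run p []      = []
  δ*-run p (a ∷ w) = x∈⁅x⁆ (δ p a) ∷ δ*-run (δ p a) w

  aperiodic : ∀ n → (∀ p w → δ* p (w ^ n) ≡ δ* p (w ^ suc n)) → AperiodicTransducer transducer
  aperiodic n same = n , λ w p q → mk⇔
    (λ ρ → subst (Run automaton p (w ^ suc n)) (trans (sym (same p w)) (run⇒δ* ρ)) (δ*-run p _))
    (λ ρ → subst (Run automaton p (w ^ n)) (trans (same p w) (run⇒δ* ρ)) (δ*-run p _))

  final-value : ∀ {q} (q∈F : q ∈ F) → fin q ≡ just (t q∈F)
  final-value {q} q∈F with fin q | trans (sym (lookup∘tabulate (is-just ∘ fin) q)) ([]=⇒lookup q∈F)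
  ... | just y | _ = refl

  final-∈ : ∀ {q y} → fin q ≡ just y → q ∈ F
  final-∈ {q} e = lookup⇒[]= q F (trans (lookup∘tabulate (is-just ∘ fin) q) (cong is-just e))

  run⇒residual : ∀ {p w q} (ρ : Run automaton p w q) (q∈F : q ∈ F) →
                 residual p w ≡ just (output ρ ++ t q∈F)
  run⇒residual [] q∈F = final-value q∈F
  run⇒residual {p} {a ∷ w} (e ∷ ρ) q∈F with x∈⁅y⁆⇒x≡y (δ p a) e
  ... | refl = trans (cong (Maybe.map (out p a ++_)) (run⇒residual ρ q∈F))
                     (cong just (sym (++-assoc (out p a) (output ρ) _)))

  residual⇒run : ∀ p w {y} → residual p w ≡ just y →
    ∃[ q ] Σ[ ρ ∈ Run automaton p w q ] Σ[ q∈F ∈ q ∈ F ] y ≡ output ρ ++ t q∈F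
  residual⇒run p [] eq = p , [] , final-∈ eq , Maybe.just-injective (trans (sym eq) (final-value (final-∈ eq)))
  residual⇒run p (a ∷ w) eq with map-just (out p a) (residual (δ p a) w) eq
  ... | z , eq′ , refl with residual⇒run (δ p a) w eq′
  ... | r , ρ , r∈F , refl = r , x∈⁅x⁆ (δ p a) ∷ ρ , r∈F , sym (++-assoc (out p a) (output ρ) _)

  transducer-correct : ∀ u v → Realized u v ⇔ (⟦ u ⟧ ≡ just v)
  transducer-correct u v = mk⇔ forward backward
    where
    forward : Realized u v → ⟦ u ⟧ ≡ just v
    forward (p , q , p∈I , ρ , q∈F , refl) with x∈⁅y⁆⇒x≡y q₀ p∈I
    ... | refl = cong (Maybe.map (ι ++_)) (run⇒residual ρ q∈F)
    backward : ⟦ u ⟧ ≡ just v → Realized u v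
    backward eq with map-just ι (residual q₀ u) eq
    ... | z , eq′ , refl with residual⇒run q₀ u eq′
    ... | q , ρ , q∈F , refl = q₀ , q , x∈⁅x⁆ q₀ , ρ , q∈F , refl

-- Stabilisation of residuals along powers of a word

module ReducedAperiodic
  (M : Machine k) (reduced : Machine.Reduced M) (T : Transducer k)
  (functional : FunctionalTransducer T)
  {n : ℕ} (aperiodic : ∀ w → TransitionEquiv (Transducer.automaton T) (w ^ n) (w ^ suc n))
  (correct : ∀ u v → Transducer.Realized T u v ⇔ (Machine.⟦_⟧ M u ≡ just v))
  where
  open Machine M
  open MachineProperties M
  open Quotient M reduced
  open Transducer T using (Realized; size)

  ⟦⟧-++ : ∀ u v → ⟦ u ++ v ⟧ ≡ Maybe.map ((ι ++ out* q₀ u) ++_) (residual (δ* q₀ u) v)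
  ⟦⟧-++ u v = trans (cong (Maybe.map (ι ++_)) (residual-++ q₀ u v))
    (map-++ ι (out* q₀ u) (residual (δ* q₀ u) v))

  δ*-loop : ∀ {p w} → δ* p w ≡ p → ∀ j → δ* p (w ^ j) ≡ p
  δ*-loop         loop zero    = refl
  δ*-loop {p} {w} loop (suc j) = trans (δ*-++ p w (w ^ j))
    (trans (cong (λ q → δ* q (w ^ j)) loop) (δ*-loop loop j))

  out*-loop : ∀ {p w} → δ* p w ≡ p → ∀ j → out* p (w ^ j) ≡ out* p w ^ j
  out*-loop         loop zero    = refl
  out*-loop {p} {w} loop (suc j) = trans (out*-++ p w (w ^ j)) (cong (out* p w ++_)
    (trans (cong (λ q → out* q (w ^ j)) loop) (out*-loop loop j)))

  -- Two of the exponents `0` to `states` lead to the same state; their difference is the period,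
  -- and `i` is at least the smaller of them. The period depends on `p` and `w`, the bound on `i`
  -- does not.
  eventually-periodic : ∀ {i} → states ≤ i → ∀ p w → ∃[ m ] δ* (δ* p (w ^ i)) (w ^ suc m) ≡ δ* p (w ^ i)
  eventually-periodic {i} states≤i p w with Fin.pigeonhole (n<1+n states) (λ j → δ* p (w ^ toℕ j))
  ... | a , b , a<b , same with m≤n⇒∃[o]m+o≡n a<b | m≤n⇒∃[o]m+o≡n (≤-trans (Fin.toℕ≤pred[n] a) states≤i)
  ... | m , a+m≡b | c , refl = m , (begin
    δ* (δ* p (w ^ (toℕ a + c))) (w ^ suc m)    ≡⟨ δ*-^ p (toℕ a + c) (suc m) ⟨
    δ* p (w ^ (toℕ a + c + suc m))             ≡⟨ cong (λ z → δ* p (w ^ z)) (rearrange (toℕ a) c m) ⟩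
    δ* p (w ^ (suc (toℕ a) + m + c))           ≡⟨ cong (λ z → δ* p (w ^ (z + c))) a+m≡b ⟩
    δ* p (w ^ (toℕ b + c))                     ≡⟨ δ*-^ p (toℕ b) c ⟩
    δ* (δ* p (w ^ toℕ b)) (w ^ c)              ≡⟨ cong (λ q → δ* q (w ^ c)) same ⟨
    δ* (δ* p (w ^ toℕ a)) (w ^ c)              ≡⟨ δ*-^ p (toℕ a) c ⟨
    δ* p (w ^ (toℕ a + c))                     ∎)
    where
    open ≡-Reasoning
    δ*-^ : ∀ p i j → δ* p (w ^ (i + j)) ≡ δ* (δ* p (w ^ i)) (w ^ j)
    δ*-^ p i j = trans (cong (δ* p) (^-+ w i j)) (δ*-++ p (w ^ i) (w ^ j))
    rearrange : ∀ a c m → a + c + suc m ≡ suc a + m + c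
    rearrange = solve-∀

  -- One exponent `i`, chosen before `u` and `w`, is large enough both for the machine to have
  -- entered its cycle and for `pumping` in `T`.
  module _ {s i : ℕ} (states≤i : states ≤ i) (size≤s : size ≤ s) (n≤s : n ≤ s) (s≤i : s + n * s ≤ i)
           (u w : Word k) where
    private
      n≤i : n ≤ i
      n≤i = ≤-trans n≤s (≤-trans (m≤m+n s _) s≤i)
      p = δ* q₀ (u ++ w ^ i)
      period = eventually-periodic states≤i (δ* q₀ u) w
      m = proj₁ period
      loop : δ* p (w ^ suc m) ≡ p
      loop = subst (λ q → δ* q (w ^ suc m) ≡ q) (sym (δ*-++ q₀ u (w ^ i))) (proj₂ period)
      loops-w : ∀ j → δ* p (w ^ (j * suc m)) ≡ p
      loops-w j = trans (cong (δ* p) (^-* w j (suc m))) (δ*-loop loop j)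
      A = ι ++ out* q₀ (u ++ w ^ i)
      B = out* p (w ^ suc m)

      regroup : ∀ j v → u ++ w ^ (i + j) ++ v ≡ (u ++ w ^ i) ++ w ^ j ++ v
      regroup j v = trans (cong (λ z → u ++ z ++ v) (^-+ w i j))
        (trans (cong (u ++_) (++-assoc (w ^ i) (w ^ j) v)) (sym (++-assoc u (w ^ i) _)))

      ⟦⟧-loops : ∀ j v → ⟦ u ++ w ^ (i + j * suc m) ++ v ⟧ ≡ Maybe.map ((A ++ B ^ j) ++_) (residual p v)
      ⟦⟧-loops j v = begin
        ⟦ u ++ w ^ (i + j * suc m) ++ v ⟧
          ≡⟨ cong ⟦_⟧ (regroup (j * suc m) v) ⟩
        ⟦ (u ++ w ^ i) ++ w ^ (j * suc m) ++ v ⟧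
          ≡⟨ ⟦⟧-++ (u ++ w ^ i) _ ⟩
        Maybe.map (A ++_) (residual p (w ^ (j * suc m) ++ v))
          ≡⟨ cong (Maybe.map (A ++_)) (residual-++ p (w ^ (j * suc m)) v) ⟩
        Maybe.map (A ++_) (Maybe.map (out* p (w ^ (j * suc m)) ++_) (residual (δ* p (w ^ (j * suc m))) v))
          ≡⟨ cong₂ (λ x q → Maybe.map (A ++_) (Maybe.map (x ++_) (residual q v)))
               (trans (cong (out* p) (^-* w j (suc m))) (out*-loop loop j)) (loops-w j) ⟩
        Maybe.map (A ++_) (Maybe.map (B ^ j ++_) (residual p v))
          ≡⟨ map-++ A (B ^ j) (residual p v) ⟩
        Maybe.map ((A ++ B ^ j) ++_) (residual p v) ∎
        where open ≡-Reasoning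

      Pumped : (v κ α β γ : Word k) → Set
      Pumped v κ α β γ = Fits m A B α β γ κ × (∀ r → Realized (u ++ w ^ (i + r) ++ v) (α ++ β ^ r ++ γ))

      fits : ∀ {v κ α β γ} → residual p v ≡ just κ →
             (∀ r → Realized (u ++ w ^ (i + r) ++ v) (α ++ β ^ r ++ γ)) → Fits m A B α β γ κ
      fits {v} {κ} {α} {β} {γ} e real j = Maybe.just-injective (begin
        just (α ++ β ^ (j * suc m) ++ γ)              ≡⟨ to (correct _ _) (real (j * suc m)) ⟨
        ⟦ u ++ w ^ (i + j * suc m) ++ v ⟧             ≡⟨ ⟦⟧-loops j v ⟩
        Maybe.map ((A ++ B ^ j) ++_) (residual p v)   ≡⟨ cong (Maybe.map ((A ++ B ^ j) ++_)) e ⟩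
        just ((A ++ B ^ j) ++ κ)                      ≡⟨ cong just (++-assoc A (B ^ j) κ) ⟩
        just (A ++ B ^ j ++ κ)                        ∎)
        where open ≡-Reasoning

      pumped : ∀ v κ → residual p v ≡ just κ → ∃[ α ] ∃[ β ] ∃[ γ ] Pumped v κ α β γ
      pumped v κ e = check (pumping T functional aperiodic size≤s n≤s s≤i u w v
        (from (correct _ _) (subst (λ z → ⟦ u ++ w ^ z ++ v ⟧ ≡ just ((A ++ []) ++ κ)) (+-identityʳ i)
          (trans (⟦⟧-loops 0 v) (cong (Maybe.map ((A ++ []) ++_)) e)))))
        where
        check : ∃[ α ] ∃[ β ] ∃[ γ ] (∀ r → Realized (u ++ w ^ (i + r) ++ v) (α ++ β ^ r ++ γ)) →
                ∃[ α ] ∃[ β ] ∃[ γ ] Pumped v κ α β γ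
        check (α , β , γ , real) = α , β , γ , fits {v} {κ} {α} {β} {γ} e real , real

      -- One copy of `w` beyond `j` full periods. Since `p` returns to itself after each period, the
      -- state reached is `δ* p w` whatever `j` is.
      later : ℕ → Word k
      later j = u ++ w ^ (i + (j * suc m + 1))

      δ*-later : ∀ j → δ* q₀ (later j) ≡ δ* p w
      δ*-later j = begin
        δ* q₀ (u ++ w ^ (i + (j * suc m + 1)))
          ≡⟨ cong (δ* q₀) (trans (cong (u ++_) (^-+ w i _)) (sym (++-assoc u (w ^ i) _))) ⟩
        δ* q₀ ((u ++ w ^ i) ++ w ^ (j * suc m + 1))
          ≡⟨ δ*-++ q₀ (u ++ w ^ i) _ ⟩
        δ* p (w ^ (j * suc m + 1))
          ≡⟨ trans (cong (δ* p) (^-+ w (j * suc m) 1)) (δ*-++ p (w ^ (j * suc m)) _) ⟩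
        δ* (δ* p (w ^ (j * suc m))) (w ^ 1)
          ≡⟨ cong₂ δ* (loops-w j) (^-1 w) ⟩
        δ* p w ∎
        where open ≡-Reasoning

      ⟦⟧-later : ∀ j v → ⟦ u ++ w ^ (i + (j * suc m + 1)) ++ v ⟧
                 ≡ Maybe.map ((ι ++ out* q₀ (later j)) ++_) (residual (δ* p w) v)
      ⟦⟧-later j v = trans (cong ⟦_⟧ (sym (++-assoc u _ v))) (trans (⟦⟧-++ (later j) v)
        (cong (λ q → Maybe.map ((ι ++ out* q₀ (later j)) ++_) (residual q v)) (δ*-later j)))

      -- The exponents `i` and `i + 1` both exceed the aperiodicity threshold of `T`, so definedness
      -- with one more `w` carries back by `domain-stable`.
      undefined-step : ∀ {v} → residual p v ≡ nothing → residual (δ* p w) v ≡ nothing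
      undefined-step {v} e = undefined (residual (δ* p w) v) refl
        where
        defined-before : ∀ {κ} → residual (δ* p w) v ≡ just κ →
                         ∃[ y ] Realized (u ++ w ^ (i + 0 * suc m) ++ v) y
        defined-before eq = domain-stable T functional aperiodic u w v
          (≤-trans n≤i (m≤m+n i (0 * suc m + 1))) (≤-trans n≤i (m≤m+n i (0 * suc m)))
          (from (correct _ _) (trans (⟦⟧-later 0 v) (cong (Maybe.map ((ι ++ out* q₀ (later 0)) ++_)) eq)))
        undefined : ∀ y → residual (δ* p w) v ≡ y → residual (δ* p w) v ≡ nothing
        undefined nothing  eq = eq
        undefined (just κ) eq = contradiction (trans
          (sym (trans (⟦⟧-loops 0 v) (cong (Maybe.map ((A ++ B ^ 0) ++_)) e)))
          (to (correct _ _) (proj₂ (defined-before eq)))) λ ()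

      dead-step : ¬ Live p → p ≈ δ* p w
      dead-step dead v = trans (dead⇒nothing p dead v) (sym (undefined-step {v} (dead⇒nothing p dead v)))

      -- The output on `later j ++ v` is computed twice: from `T` it is `x ++ κ` with `κ` the output
      -- from `p` on `v`, and from the machine it is the output from `δ* p w` behind a prefix.
      -- Neither left factor depends on `v`.
      shifted : ∀ {j x} → (∀ α β γ κ → Fits m A B α β γ κ → α ++ β ^ (j * suc m + 1) ++ γ ≡ x ++ κ) →
                ∀ v → Maybe.map (x ++_) (residual p v)
                      ≡ Maybe.map ((ι ++ out* q₀ (later j)) ++_) (residual (δ* p w) v)
      shifted {j} {x} shift v = defined (residual p v) refl
        where
        finish : ∀ κ → ∃[ α ] ∃[ β ] ∃[ γ ] Pumped v κ α β γ →
                 just (x ++ κ) ≡ Maybe.map ((ι ++ out* q₀ (later j)) ++_) (residual (δ* p w) v)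
        finish κ (α , β , γ , fits , real) = trans (cong just (sym (shift α β γ κ fits)))
          (trans (sym (to (correct _ _) (real (j * suc m + 1)))) (⟦⟧-later j v))
        defined : ∀ y → residual p v ≡ y → Maybe.map (x ++_) (residual p v)
                  ≡ Maybe.map ((ι ++ out* q₀ (later j)) ++_) (residual (δ* p w) v)
        defined nothing  e = trans (cong (Maybe.map (x ++_)) e)
          (sym (cong (Maybe.map ((ι ++ out* q₀ (later j)) ++_)) (undefined-step {v} e)))
        defined (just κ) e = trans (cong (Maybe.map (x ++_)) e) (finish κ (pumped v κ e))

      -- A single accepted continuation `v₀` supplies the reference data from which `uniform-shift`
      -- fixes `j` and `x` for all continuations.
      live-step : Live p → p ≈ δ* p w
      live-step live@(v₀ , κ₀ , e₀) = from-pumped (pumped v₀ κ₀ e₀)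
        where
        from-shift : ∃[ j ] ∃[ x ] (∀ α β γ κ → Fits m A B α β γ κ → α ++ β ^ (j * suc m + 1) ++ γ ≡ x ++ κ) →
                     p ≈ δ* p w
        from-shift (j , x , shift) =
          synchronise-≈ {p} {δ* p w} x (ι ++ out* q₀ (later j)) live (shifted {j} {x} shift)
        from-pumped : ∃[ α ] ∃[ β ] ∃[ γ ] Pumped v₀ κ₀ α β γ → p ≈ δ* p w
        from-pumped (α , β , γ , fits , _) = from-shift (uniform-shift m A B α β γ κ₀ fits)

      step : p ≈ δ* p w
      step with live? p
      ... | yes live = live-step live
      ... | no  dead = dead-step dead

    stabilises : δ* (δ* q₀ u) (w ^ i) ≈ δ* (δ* q₀ u) (w ^ suc i)
    stabilises = subst₂ _≈_ (δ*-++ q₀ u (w ^ i)) (begin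
      δ* (δ* q₀ (u ++ w ^ i)) w           ≡⟨ cong (λ q → δ* q w) (δ*-++ q₀ u (w ^ i)) ⟩
      δ* (δ* (δ* q₀ u) (w ^ i)) w         ≡⟨ δ*-++ (δ* q₀ u) (w ^ i) w ⟨
      δ* (δ* q₀ u) (w ^ i ++ w)           ≡⟨ cong (δ* (δ* q₀ u)) (++-commute-^ w w w i refl) ⟩
      δ* (δ* q₀ u) (w ^ suc i)            ∎) step
      where open ≡-Reasoning

-- The two directions of the equivalence

sequential⇒functional : (f : Transduction k) (T : Transducer k) → Realizes T f → FunctionalTransducer T
sequential⇒functional f T realizes r r′ =
  Transduction.isPartialFunction f (from (realizes _ _) r) (from (realizes _ _) r′)

theorem2p4 : ∀ {k : ℕ} (f : Transduction k) → Sequential f → (Ap-Sequential f ⇔ Ap-Rational f)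
theorem2p4 {k} f (D , D-sequential , D-realizes) = mk⇔
  (λ (T , _ , aperiodic , realizes) → T , sequential⇒functional f T realizes , aperiodic , realizes)
  backward
  where
  -- The resulting transducer is built from `D` alone; the aperiodic functional transducer enters
  -- only in the proof that it is aperiodic.
  module D = FromTransducer D D-sequential
  module P = Push D.machine
  module Q = Quotient P.pushed P.pushed-reduced
  module R = ToTransducer Q.quotient
  open Machine using (⟦_⟧)

  meaning : ∀ u → ⟦ Q.quotient ⟧ u ≡ ⟦ D.machine ⟧ u
  meaning u = trans (Q.⟦quotient⟧ u) (sym (P.⟦pushed⟧ u))

  R-realizes : Realizes R.transducer f
  R-realizes u v = mk⇔
    (λ g → from (R.transducer-correct u v) (trans (meaning u) (to (D.machine-correct u v) (to (D-realizes u v) g))))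
    (λ r → from (D-realizes u v) (from (D.machine-correct u v)
             (trans (sym (meaning u)) (to (R.transducer-correct u v) r))))

  backward : Ap-Rational f → Ap-Sequential f
  backward (T , functional , (n , aperiodic) , realizes) =
    R.transducer , R.sequential , R.aperiodic (suc i) (Q.quotient-aperiodic i accessible-stabilises) , R-realizes
    where
    correct : ∀ u v → Transducer.Realized T u v ⇔ (⟦ P.pushed ⟧ u ≡ just v)
    correct u v = mk⇔
      (λ r → trans (sym (P.⟦pushed⟧ u)) (to (D.machine-correct u v) (to (D-realizes u v) (from (realizes u v) r))))
      (λ e → to (realizes u v) (from (D-realizes u v) (from (D.machine-correct u v) (trans (P.⟦pushed⟧ u) e))))
    -- `s` dominates both the size of `T` and its aperiodicity threshold, and `i` adds the bounds
    -- for the cycle and for pumping. The exponent used is `suc i`, as the quotient needs a positive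
    -- one.
    s = Transducer.size T + n
    N = Machine.states P.pushed
    i = N + (s + n * s)
    open Machine P.pushed using (Accessible; δ*; _≈_)
    accessible-stabilises : ∀ p → Accessible p → ∀ w → δ* p (w ^ suc i) ≈ δ* p (w ^ suc (suc i))
    accessible-stabilises p (u , refl) w =
      ReducedAperiodic.stabilises P.pushed P.pushed-reduced T functional aperiodic correct {s} {suc i}
        (m≤n⇒m≤1+n (m≤m+n N _)) (m≤m+n _ n) (m≤n+m n _) (m≤n⇒m≤1+n (m≤n+m _ N)) u w
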